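{- Let $n\ge 2$. For all $A,B_1,\dots,B_n,C\in\widehat{\mathbb{F}_q^\times}$ and all $\lambda_1,\dots,\lambda_n\in\mathbb{F}_q$, $$\mathbb{F}_D^{(n)}\left[\begin{matrix}A; & B_1\ \cdots\ B_n\\ & C\end{matrix};\lambda_1,\dots,\lambda_n\right]=\frac{J(A,\overline{C}B_1B_2\cdots B_n)}{A(-1)\,J(A,C\overline{A})}\;\mathbb{F}_D^{(n)}\left[\begin{matrix}A; & B_1\ \cdots\ B_n\\ & A\overline{C}B_1B_2\cdots B_n\end{matrix};1-\lambda_1,\dots,1-\lambda_n\right].$$
   Context: $\mathbb{F}_q$ is a finite field with $q=p^e$, $p$ an odd prime. $\widehat{\mathbb{F}_q^\times}$ is the group of complex-valued multiplicative characters of $\mathbb{F}_q^\times$; every character $\chi$, including the trivial one, is extended to $\mathbb{F}_q$ by $\chi(0)=0$, and $\overline{\chi}=\chi^{ -1}$. The Jacobi sum is $J(A,B)=\sum_{x\in\mathbb{F}_q}A(x)B(1-x)$. The finite-field Appell-Lauricella hypergeometric function is $$\mathbb{F}_D^{(n)}\left[\begin{matrix}A; & B_1\ \cdots\ B_n\\ & C\end{matrix};\lambda_1,\dots,\lambda_n\right]=\frac{1}{J(A,C\overline{A})}\sum_{y\in\mathbb{F}_q}A(y)\,C\overline{A}(1-y)\,\overline{B_1}(1-\lambda_1y)\cdots\overline{B_n}(1-\lambda_ny).$$ -}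

module Defs where

open import Algebra.Bundles using (CommutativeRing; AbelianGroup)
open import Algebra.Definitions using (Invertible)
open import Algebra.Morphism.Structures using (IsGroupHomomorphism)
import Algebra.Properties.AbelianGroup as AbelianGroupProperties
import Algebra.Properties.Ring as RingProperties
import Algebra.Properties.CommutativeMonoid.Sum as CommutativeMonoidSum
import Algebra.Properties.CommutativeSemigroup as CommutativeSemigroupProperties
import Algebra.Solver.Ring.NaturalCoefficients.Default as NaturalCoefficients
open import Data.Fin.Base using (Fin)
import Data.Fin.Properties as Fin
open import Data.Nat.Base as ℕ using (ℕ)
import Data.Nat.Properties as ℕ
open import Data.Product.Base using (∃-syntax; _×_; _,_; proj₁; proj₂)
open import Data.Rational.Base as ℚ using (ℚ; 0ℚ; 1ℚ; ½; ∣_∣)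
import Data.Rational.Properties as ℚ
open import Data.Rational.Solver using (module +-*-Solver)
open import Data.Vec.Functional using (Vector)
open import Function.Bundles using (Inverse)
open import Function.Properties.Inverse using (Inverse⇒Injection)
import Function.Properties.Inverse as Inverse
open import Level using (Level; 0ℓ; _⊔_; suc)
open import Relation.Binary.PropositionalEquality as ≡ using (_≡_)
import Relation.Binary.Reasoning.Setoid as ≈-Reasoning
open import Relation.Nullary using (¬_; Dec; yes; no)
open import Relation.Nullary.Decidable using (via-injection)

-- Asymptotic agreement of two rational sequences, with two independent
-- indices: `Close x x` says that x is Cauchy, and for Cauchy x and y,
-- `Close x y` says that x and y have the same limit.

Close : (x y : ℕ → ℚ) → Set
Close x y = ∀ ε → 0ℚ ℚ.< ε →
  ∃[ N ] ∀ m n → N ℕ.≤ m → N ℕ.≤ n → ∣ x m ℚ.- y n ∣ ℚ.< ε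

module CloseProperties where

  ½-pos : ∀ {ε} → 0ℚ ℚ.< ε → 0ℚ ℚ.< ½ ℚ.* ε
  ½-pos {ε} ε>0 = ℚ.*-monoʳ-<-pos ½ ε>0

  ½+½ : ∀ ε → ½ ℚ.* ε ℚ.+ ½ ℚ.* ε ≡ ε
  ½+½ ε = ≡.trans (≡.sym (ℚ.*-distribʳ-+ ε ½ ½)) (ℚ.*-identityˡ ε)

  triangle : ∀ a b c → ∣ a ℚ.- c ∣ ℚ.≤ ∣ a ℚ.- b ∣ ℚ.+ ∣ b ℚ.- c ∣
  triangle a b c = ℚ.≤-trans (ℚ.≤-reflexive (≡.cong ∣_∣ (split a b c)))
                             (ℚ.∣p+q∣≤∣p∣+∣q∣ (a ℚ.- b) (b ℚ.- c))
    where
    open +-*-Solver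
    split : ∀ a b c → a ℚ.- c ≡ (a ℚ.- b) ℚ.+ (b ℚ.- c)
    split = solve 3 (λ a b c → a :- c := (a :- b) :+ (b :- c)) ≡.refl

  swap-abs : ∀ a b → ∣ a ℚ.- b ∣ ≡ ∣ b ℚ.- a ∣
  swap-abs a b = ≡.trans (≡.cong ∣_∣ (flip a b)) (ℚ.∣-p∣≡∣p∣ (b ℚ.- a))
    where
    open +-*-Solver
    flip : ∀ a b → a ℚ.- b ≡ ℚ.- (b ℚ.- a)
    flip = solve 2 (λ a b → a :- b := :- (b :- a)) ≡.refl

  halves : ∀ {a b c} ε → a ℚ.≤ b ℚ.+ c → b ℚ.< ½ ℚ.* ε → c ℚ.< ½ ℚ.* ε → a ℚ.< ε
  halves ε a≤b+c b< c< = ℚ.≤-<-trans a≤b+c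
    (ℚ.<-≤-trans (ℚ.+-mono-< b< c<) (ℚ.≤-reflexive (½+½ ε)))

  close-sym : ∀ {x y} → Close x y → Close y x
  close-sym {x} {y} p ε ε>0 with p ε ε>0
  ... | N , h = N , λ m n N≤m N≤n →
    ≡.subst (ℚ._< ε) (swap-abs (x n) (y m)) (h n m N≤n N≤m)

  close-trans : ∀ {x y z} → Close x y → Close y z → Close x z
  close-trans {x} {y} {z} p q ε ε>0 with p (½ ℚ.* ε) (½-pos ε>0) | q (½ ℚ.* ε) (½-pos ε>0)
  ... | N , h | K , k = N ℕ.⊔ K , λ m n ≤m ≤n →
    halves ε (triangle (x m) (y (N ℕ.⊔ K)) (z n))
      (h m (N ℕ.⊔ K) (ℕ.m⊔n≤o⇒m≤o N K ≤m) (ℕ.m≤m⊔n N K))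
      (k (N ℕ.⊔ K) n (ℕ.m≤n⊔m N K) (ℕ.m⊔n≤o⇒n≤o N K ≤n))

  close-pointwise : ∀ {x y} → Close x x → (∀ n → x n ≡ y n) → Close x y
  close-pointwise {x} p x≡y ε ε>0 with p ε ε>0
  ... | N , h = N , λ m n N≤m N≤n →
    ≡.subst (λ t → ∣ x m ℚ.- t ∣ ℚ.< ε) (x≡y n) (h m n N≤m N≤n)

  close-const : ∀ q → Close (λ _ → q) (λ _ → q)
  close-const q ε ε>0 = 0 , λ _ _ _ _ →
    ≡.subst (ℚ._< ε) (≡.sym (≡.cong ∣_∣ (ℚ.+-inverseʳ q))) ε>0

  close-neg : ∀ {x y} → Close x y → Close (λ n → ℚ.- x n) (λ n → ℚ.- y n)
  close-neg {x} {y} p ε ε>0 with p ε ε>0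
  ... | N , h = N , λ m n N≤m N≤n →
    ≡.subst (ℚ._< ε) (lemma (x m) (y n)) (h m n N≤m N≤n)
    where
    open +-*-Solver
    lemma : ∀ a b → ∣ a ℚ.- b ∣ ≡ ∣ ℚ.- a ℚ.- ℚ.- b ∣
    lemma a b = ≡.trans (≡.sym (ℚ.∣-p∣≡∣p∣ (a ℚ.- b)))
      (≡.cong ∣_∣ (solve 2 (λ a b → :- (a :- b) := :- a :- (:- b)) ≡.refl a b))

  close-+ : ∀ {x x′ y y′} → Close x x′ → Close y y′ →
            Close (λ n → x n ℚ.+ y n) (λ n → x′ n ℚ.+ y′ n)
  close-+ {x} {x′} {y} {y′} p q ε ε>0 with p (½ ℚ.* ε) (½-pos ε>0) | q (½ ℚ.* ε) (½-pos ε>0)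
  ... | N , h | K , k = N ℕ.⊔ K , λ m n ≤m ≤n →
    halves ε (lemma (x m) (y m) (x′ n) (y′ n))
      (h m n (ℕ.m⊔n≤o⇒m≤o N K ≤m) (ℕ.m⊔n≤o⇒m≤o N K ≤n))
      (k m n (ℕ.m⊔n≤o⇒n≤o N K ≤m) (ℕ.m⊔n≤o⇒n≤o N K ≤n))
    where
    open +-*-Solver
    lemma : ∀ a b c d → ∣ (a ℚ.+ b) ℚ.- (c ℚ.+ d) ∣ ℚ.≤ ∣ a ℚ.- c ∣ ℚ.+ ∣ b ℚ.- d ∣
    lemma a b c d = ℚ.≤-trans
      (ℚ.≤-reflexive (≡.cong ∣_∣
        (solve 4 (λ a b c d → (a :+ b) :- (c :+ d) := (a :- c) :+ (b :- d)) ≡.refl a b c d)))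
      (ℚ.∣p+q∣≤∣p∣+∣q∣ (a ℚ.- c) (b ℚ.- d))

  bound : ∀ {x x′} → Close x x′ →
          ∃[ M ] (0ℚ ℚ.< M) × ∃[ N ] ∀ m → N ℕ.≤ m → ∣ x m ∣ ℚ.≤ M
  bound {x} {x′} p with p 1ℚ (ℚ.positive⁻¹ 1ℚ)
  ... | N , h = 1ℚ ℚ.+ ∣ x′ N ∣
    , ℚ.+-mono-<-≤ (ℚ.positive⁻¹ 1ℚ) (ℚ.0≤∣p∣ (x′ N))
    , N
    , λ m N≤m → ℚ.≤-trans (lemma (x m) (x′ N))
        (ℚ.+-monoˡ-≤ ∣ x′ N ∣ (ℚ.<⇒≤ (h m N N≤m ℕ.≤-refl)))
    where
    open +-*-Solver
    lemma : ∀ a b → ∣ a ∣ ℚ.≤ ∣ a ℚ.- b ∣ ℚ.+ ∣ b ∣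
    lemma a b = ℚ.≤-trans
      (ℚ.≤-reflexive (≡.cong ∣_∣ (solve 2 (λ a b → a := (a :- b) :+ b) ≡.refl a b)))
      (ℚ.∣p+q∣≤∣p∣+∣q∣ (a ℚ.- b) b)

  shrink : ∀ {M ε} → 0ℚ ℚ.< M → 0ℚ ℚ.< ε → ∃[ δ ] (0ℚ ℚ.< δ) × M ℚ.* δ ≡ ε
  shrink {M} {ε} M>0 ε>0 = M⁻¹ ℚ.* ε
    , ≡.subst (ℚ._< M⁻¹ ℚ.* ε) (ℚ.*-zeroʳ M⁻¹) (ℚ.*-monoʳ-<-pos M⁻¹ ε>0)
    , ≡.trans (≡.sym (ℚ.*-assoc M M⁻¹ ε))
        (≡.trans (≡.cong (ℚ._* ε) (ℚ.*-inverseʳ M)) (ℚ.*-identityˡ ε))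
    where
    instance
      M-pos : ℚ.Positive M
      M-pos = ℚ.positive M>0
      M-nonZero : ℚ.NonZero M
      M-nonZero = ℚ.pos⇒nonZero M
    M⁻¹ : ℚ
    M⁻¹ = ℚ.1/ M
    instance
      M⁻¹-pos : ℚ.Positive M⁻¹
      M⁻¹-pos = ℚ.1/pos⇒pos M

  scaled : ∀ {M δ ε a b} → 0ℚ ℚ.< M → M ℚ.* δ ≡ ε → ∣ a ∣ ℚ.≤ M → ∣ b ∣ ℚ.< δ →
           ∣ a ℚ.* b ∣ ℚ.< ε
  scaled {M} {δ} {ε} {a} {b} M>0 Mδ≡ε a≤M b<δ = begin-strict
    ∣ a ℚ.* b ∣      ≡⟨ ℚ.∣p*q∣≡∣p∣*∣q∣ a b ⟩
    ∣ a ∣ ℚ.* ∣ b ∣  ≤⟨ ℚ.*-monoʳ-≤-nonNeg ∣ b ∣ a≤M ⟩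
    M ℚ.* ∣ b ∣      <⟨ ℚ.*-monoʳ-<-pos M b<δ ⟩
    M ℚ.* δ          ≡⟨ Mδ≡ε ⟩
    ε                ∎
    where
    open ℚ.≤-Reasoning
    instance
      b-nonNeg : ℚ.NonNegative ∣ b ∣
      b-nonNeg = ℚ.∣-∣-nonNeg b
      M-pos : ℚ.Positive M
      M-pos = ℚ.positive M>0

  product-estimate : ∀ a b c d →
    ∣ a ℚ.* b ℚ.- c ℚ.* d ∣ ℚ.≤ ∣ a ℚ.* (b ℚ.- d) ∣ ℚ.+ ∣ d ℚ.* (a ℚ.- c) ∣
  product-estimate a b c d = ℚ.≤-trans (triangle (a ℚ.* b) (a ℚ.* d) (c ℚ.* d))
    (ℚ.≤-reflexive (≡.cong₂ (λ s t → ∣ s ∣ ℚ.+ ∣ t ∣) (left a b d) (right a c d)))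
    where
    open +-*-Solver
    left : ∀ a b d → a ℚ.* b ℚ.- a ℚ.* d ≡ a ℚ.* (b ℚ.- d)
    left = solve 3 (λ a b d → a :* b :- a :* d := a :* (b :- d)) ≡.refl
    right : ∀ a c d → a ℚ.* d ℚ.- c ℚ.* d ≡ d ℚ.* (a ℚ.- c)
    right = solve 3 (λ a c d → a :* d :- c :* d := d :* (a :- c)) ≡.refl

  close-* : ∀ {x x′ y y′} → Close x x′ → Close y y′ →
            Close (λ n → x n ℚ.* y n) (λ n → x′ n ℚ.* y′ n)
  close-* {x} {x′} {y} {y′} p q ε ε>0 =
    step (bound {x} {x′} p) (bound {y′} {y} (close-sym {y} {y′} q))
    where
    η : ℚ
    η = ½ ℚ.* ε

    Bounded : (ℕ → ℚ) → Set
    Bounded z = ∃[ M ] (0ℚ ℚ.< M) × ∃[ N ] ∀ m → N ℕ.≤ m → ∣ z m ∣ ℚ.≤ M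

    Controls : (ℕ → ℚ) → (a b : ℕ → ℚ) → Set
    Controls z a b =
      ∃[ N ] ∀ k m n → N ℕ.≤ k → N ℕ.≤ m → N ℕ.≤ n → ∣ z k ℚ.* (a m ℚ.- b n) ∣ ℚ.< η

    control : ∀ {z a b} → Bounded z → Close a b → Controls z a b
    control {z} {a} {b} (M , M>0 , I , z≤M) r = build (shrink M>0 (½-pos ε>0))
      where
      build : ∃[ δ ] (0ℚ ℚ.< δ) × M ℚ.* δ ≡ η → Controls z a b
      build (δ , δ>0 , Mδ) = I ℕ.⊔ proj₁ (r δ δ>0) , λ k m n ≤k ≤m ≤n →
        scaled {a = z k} {b = a m ℚ.- b n} M>0 Mδ
          (z≤M k (ℕ.m⊔n≤o⇒m≤o I (proj₁ (r δ δ>0)) ≤k))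
          (proj₂ (r δ δ>0) m n (ℕ.m⊔n≤o⇒n≤o I (proj₁ (r δ δ>0)) ≤m)
                               (ℕ.m⊔n≤o⇒n≤o I (proj₁ (r δ δ>0)) ≤n))

    combine : Controls x y y′ → Controls y′ x x′ →
      ∃[ N ] ∀ m n → N ℕ.≤ m → N ℕ.≤ n → ∣ x m ℚ.* y m ℚ.- x′ n ℚ.* y′ n ∣ ℚ.< ε
    combine (N , h) (K , k) = N ℕ.⊔ K , λ m n ≤m ≤n →
      halves ε (product-estimate (x m) (y m) (x′ n) (y′ n))
        (h m m n (ℕ.m⊔n≤o⇒m≤o N K ≤m) (ℕ.m⊔n≤o⇒m≤o N K ≤m) (ℕ.m⊔n≤o⇒m≤o N K ≤n))
        (k n m n (ℕ.m⊔n≤o⇒n≤o N K ≤n) (ℕ.m⊔n≤o⇒n≤o N K ≤m) (ℕ.m⊔n≤o⇒n≤o N K ≤n))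

    step : Bounded x → Bounded y′ →
      ∃[ N ] ∀ m n → N ℕ.≤ m → N ℕ.≤ n → ∣ x m ℚ.* y m ℚ.- x′ n ℚ.* y′ n ∣ ℚ.< ε
    step bx by = combine (control {x} {y} {y′} bx q) (control {y′} {x} {x′} by p)

open CloseProperties

-- ℝ is the setoid of Cauchy sequences with `Close` as equality.  Here and
-- below, records are declared without η to keep conversion checking cheap.

record ℝ : Set where
  no-eta-equality
  constructor mkℝ
  field
    seq    : ℕ → ℚ
    cauchy : Close seq seq

open ℝ public

infix 4 _≈ℝ_

record _≈ℝ_ (x y : ℝ) : Set where
  constructor mk≈ℝ
  field
    close : Close (seq x) (seq y)

open _≈ℝ_ public

fromℚ : ℚ → ℝ
fromℚ q = mkℝ (λ _ → q) (close-const q)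

infixl 6 _+ℝ_
infixl 7 _*ℝ_
infix  8 -ℝ_

_+ℝ_ : ℝ → ℝ → ℝ
seq (x +ℝ y) n = seq x n ℚ.+ seq y n
cauchy (x +ℝ y) = close-+ {seq x} {seq x} {seq y} {seq y} (cauchy x) (cauchy y)

_*ℝ_ : ℝ → ℝ → ℝ
seq (x *ℝ y) n = seq x n ℚ.* seq y n
cauchy (x *ℝ y) = close-* {seq x} {seq x} {seq y} {seq y} (cauchy x) (cauchy y)

-ℝ_ : ℝ → ℝ
seq (-ℝ x) n = ℚ.- seq x n
cauchy (-ℝ x) = close-neg {seq x} {seq x} (cauchy x)

private
  pointwise : ∀ x y → (∀ n → seq x n ≡ seq y n) → x ≈ℝ y
  pointwise x y x≡y = mk≈ℝ (close-pointwise {seq x} {seq y} (cauchy x) x≡y)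

ℝ-commutativeRing : CommutativeRing 0ℓ 0ℓ
ℝ-commutativeRing = record
  { Carrier = ℝ
  ; _≈_ = _≈ℝ_
  ; _+_ = _+ℝ_
  ; _*_ = _*ℝ_
  ; -_ = -ℝ_
  ; 0# = fromℚ 0ℚ
  ; 1# = fromℚ 1ℚ
  ; isCommutativeRing = record
    { isRing = record
      { +-isAbelianGroup = record
        { isGroup = record
          { isMonoid = record
            { isSemigroup = record
              { isMagma = record
                { isEquivalence = record
                  { refl = λ {x} → mk≈ℝ (cauchy x)
                  ; sym = λ {x} {y} p → mk≈ℝ (close-sym {seq x} {seq y} (close p))
                  ; trans = λ {x} {y} {z} p q →
                      mk≈ℝ (close-trans {seq x} {seq y} {seq z} (close p) (close q))
                  }
                ; ∙-cong = λ {x} {x′} {y} {y′} p q →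
                    mk≈ℝ (close-+ {seq x} {seq x′} {seq y} {seq y′} (close p) (close q))
                }
              ; assoc = λ x y z → pointwise ((x +ℝ y) +ℝ z) (x +ℝ (y +ℝ z))
                  λ n → ℚ.+-assoc (seq x n) (seq y n) (seq z n)
              }
            ; identity = (λ x → pointwise (fromℚ 0ℚ +ℝ x) x λ n → ℚ.+-identityˡ (seq x n))
                       , (λ x → pointwise (x +ℝ fromℚ 0ℚ) x λ n → ℚ.+-identityʳ (seq x n))
            }
          ; inverse = (λ x → pointwise (-ℝ x +ℝ x) (fromℚ 0ℚ) λ n → ℚ.+-inverseˡ (seq x n))
                    , (λ x → pointwise (x +ℝ -ℝ x) (fromℚ 0ℚ) λ n → ℚ.+-inverseʳ (seq x n))
          ; ⁻¹-cong = λ {x} {y} p → mk≈ℝ (close-neg {seq x} {seq y} (close p))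
          }
        ; comm = λ x y → pointwise (x +ℝ y) (y +ℝ x) λ n → ℚ.+-comm (seq x n) (seq y n)
        }
      ; *-cong = λ {x} {x′} {y} {y′} p q →
          mk≈ℝ (close-* {seq x} {seq x′} {seq y} {seq y′} (close p) (close q))
      ; *-assoc = λ x y z → pointwise ((x *ℝ y) *ℝ z) (x *ℝ (y *ℝ z))
          λ n → ℚ.*-assoc (seq x n) (seq y n) (seq z n)
      ; *-identity = (λ x → pointwise (fromℚ 1ℚ *ℝ x) x λ n → ℚ.*-identityˡ (seq x n))
                   , (λ x → pointwise (x *ℝ fromℚ 1ℚ) x λ n → ℚ.*-identityʳ (seq x n))
      ; distrib = (λ x y z → pointwise (x *ℝ (y +ℝ z)) (x *ℝ y +ℝ x *ℝ z)
                     λ n → ℚ.*-distribˡ-+ (seq x n) (seq y n) (seq z n))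
                , (λ x y z → pointwise ((y +ℝ z) *ℝ x) (y *ℝ x +ℝ z *ℝ x)
                     λ n → ℚ.*-distribʳ-+ (seq x n) (seq y n) (seq z n))
      }
    ; *-comm = λ x y → pointwise (x *ℝ y) (y *ℝ x) λ n → ℚ.*-comm (seq x n) (seq y n)
    }
  }

-- R[i] with i² = -1; the constructor is written `a +i b`.

module AdjoinI {c ℓ} (R : CommutativeRing c ℓ) where

  private
    module R = CommutativeRing R
    open R using (_+_; _*_; -_; 0#; 1#)
    open RingProperties R.ring using (-0#≈0#; -1*x≈-x)

  infix 4 _≈ᵢ_
  infixl 6 _+ᵢ_
  infixl 7 _*ᵢ_
  infix  8 -ᵢ_

  record Carrier : Set c where
    no-eta-equality
    constructor _+i_
    field
      re im : R.Carrier

  open Carrier public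

  record _≈ᵢ_ (z w : Carrier) : Set ℓ where
    constructor mk≈ᵢ
    field
      re-≈ : re z R.≈ re w
      im-≈ : im z R.≈ im w

  open _≈ᵢ_ public

  _+ᵢ_ : Carrier → Carrier → Carrier
  re (z +ᵢ w) = re z + re w
  im (z +ᵢ w) = im z + im w

  _*ᵢ_ : Carrier → Carrier → Carrier
  re (z *ᵢ w) = re z * re w + - (im z * im w)
  im (z *ᵢ w) = re z * im w + im z * re w

  -ᵢ_ : Carrier → Carrier
  re (-ᵢ z) = - re z
  im (-ᵢ z) = - im z

  private
    open NaturalCoefficients R.commutativeSemiring using (solve; _:=_; _:+_; _:*_)

    -1# : R.Carrier
    -1# = - 1#

    neg : ∀ x → - x R.≈ -1# * x
    neg x = R.sym (-1*x≈-x x)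

    one : Carrier
    one = 1# +i 0#

    ≈ᵢ-trans : ∀ {z w v} → z ≈ᵢ w → w ≈ᵢ v → z ≈ᵢ v
    ≈ᵢ-trans (mk≈ᵢ p q) (mk≈ᵢ r s) = mk≈ᵢ (R.trans p r) (R.trans q s)

    *ᵢ-comm : ∀ z w → z *ᵢ w ≈ᵢ w *ᵢ z
    *ᵢ-comm z w = mk≈ᵢ
      (R.+-cong (R.*-comm (re z) (re w)) (R.-‿cong (R.*-comm (im z) (im w))))
      (R.trans (R.+-comm (re z * im w) (im z * re w))
        (R.+-cong (R.*-comm (im z) (re w)) (R.*-comm (re z) (im w))))

    identityˡ : ∀ z → one *ᵢ z ≈ᵢ z
    identityˡ z = mk≈ᵢ
      (R.trans (R.+-cong (R.*-identityˡ (re z)) (R.trans (R.-‿cong (R.zeroˡ (im z))) -0#≈0#))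
        (R.+-identityʳ (re z)))
      (R.trans (R.+-cong (R.*-identityˡ (im z)) (R.zeroˡ (re z))) (R.+-identityʳ (im z)))

    +ᵢ-cong : ∀ {z z′ w w′} → z ≈ᵢ z′ → w ≈ᵢ w′ → z +ᵢ w ≈ᵢ z′ +ᵢ w′
    +ᵢ-cong (mk≈ᵢ p q) (mk≈ᵢ r s) = mk≈ᵢ (R.+-cong p r) (R.+-cong q s)

    *ᵢ-assoc : ∀ z w v → (z *ᵢ w) *ᵢ v ≈ᵢ z *ᵢ (w *ᵢ v)
    *ᵢ-assoc z w t = mk≈ᵢ
      (R.trans (R.+-cong (R.*-congʳ (R.+-congˡ (neg _))) (neg _))
        (R.trans
          (solve 7 (λ a b x y u v m →
            (a :* x :+ m :* (b :* y)) :* u :+ m :* ((a :* y :+ b :* x) :* v)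
            := a :* (x :* u :+ m :* (y :* v)) :+ m :* (b :* (x :* v :+ y :* u)))
            R.refl (re z) (im z) (re w) (im w) (re t) (im t) -1#)
          (R.sym (R.+-cong (R.*-congˡ (R.+-congˡ (neg _))) (neg _)))))
      (R.trans (R.+-congʳ (R.*-congʳ (R.+-congˡ (neg _))))
        (R.trans
          (solve 7 (λ a b x y u v m →
            (a :* x :+ m :* (b :* y)) :* v :+ (a :* y :+ b :* x) :* u
            := a :* (x :* v :+ y :* u) :+ b :* (x :* u :+ m :* (y :* v)))
            R.refl (re z) (im z) (re w) (im w) (re t) (im t) -1#)
          (R.sym (R.+-congˡ (R.*-congˡ (R.+-congˡ (neg _)))))))

    distribˡ : ∀ z w v → z *ᵢ (w +ᵢ v) ≈ᵢ z *ᵢ w +ᵢ z *ᵢ v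
    distribˡ z w t = mk≈ᵢ
      (R.trans (R.+-congˡ (neg _))
        (R.trans
          (solve 7 (λ a b x y u v m →
            a :* (x :+ u) :+ m :* (b :* (y :+ v))
            := (a :* x :+ m :* (b :* y)) :+ (a :* u :+ m :* (b :* v)))
            R.refl (re z) (im z) (re w) (im w) (re t) (im t) -1#)
          (R.sym (R.+-cong (R.+-congˡ (neg _)) (R.+-congˡ (neg _))))))
      (solve 6 (λ a b x y u v →
        a :* (y :+ v) :+ b :* (x :+ u)
        := (a :* y :+ b :* x) :+ (a :* v :+ b :* u))
        R.refl (re z) (im z) (re w) (im w) (re t) (im t))

  commutativeRing : CommutativeRing c ℓ
  commutativeRing = record
    { Carrier = Carrier
    ; _≈_ = _≈ᵢ_
    ; _+_ = _+ᵢ_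
    ; _*_ = _*ᵢ_
    ; -_ = -ᵢ_
    ; 0# = 0# +i 0#
    ; 1# = 1# +i 0#
    ; isCommutativeRing = record
      { isRing = record
        { +-isAbelianGroup = record
          { isGroup = record
            { isMonoid = record
              { isSemigroup = record
                { isMagma = record
                  { isEquivalence = record
                    { refl = mk≈ᵢ R.refl R.refl
                    ; sym = λ (mk≈ᵢ p q) → mk≈ᵢ (R.sym p) (R.sym q)
                    ; trans = ≈ᵢ-trans
                    }
                  ; ∙-cong = +ᵢ-cong
                  }
                ; assoc = λ z w t → mk≈ᵢ
                    (R.+-assoc (re z) (re w) (re t)) (R.+-assoc (im z) (im w) (im t))
                }
              ; identity = (λ z → mk≈ᵢ (R.+-identityˡ (re z)) (R.+-identityˡ (im z)))
                         , (λ z → mk≈ᵢ (R.+-identityʳ (re z)) (R.+-identityʳ (im z)))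
              }
            ; inverse = (λ z → mk≈ᵢ (R.-‿inverseˡ (re z)) (R.-‿inverseˡ (im z)))
                      , (λ z → mk≈ᵢ (R.-‿inverseʳ (re z)) (R.-‿inverseʳ (im z)))
            ; ⁻¹-cong = λ (mk≈ᵢ p q) → mk≈ᵢ (R.-‿cong p) (R.-‿cong q)
            }
          ; comm = λ z w → mk≈ᵢ (R.+-comm (re z) (re w)) (R.+-comm (im z) (im w))
          }
        ; *-cong = λ (mk≈ᵢ p q) (mk≈ᵢ r s) → mk≈ᵢ
            (R.+-cong (R.*-cong p r) (R.-‿cong (R.*-cong q s)))
            (R.+-cong (R.*-cong p s) (R.*-cong q r))
        ; *-assoc = *ᵢ-assoc
        ; *-identity = identityˡ , λ z → ≈ᵢ-trans (*ᵢ-comm z one) (identityˡ z)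
        ; distrib = distribˡ , λ z w v → ≈ᵢ-trans (*ᵢ-comm (w +ᵢ v) z)
            (≈ᵢ-trans (distribˡ z w v) (+ᵢ-cong (*ᵢ-comm z w) (*ᵢ-comm z v)))
        }
      ; *-comm = *ᵢ-comm
      }
    }

ℂ-commutativeRing : CommutativeRing 0ℓ 0ℓ
ℂ-commutativeRing = AdjoinI.commutativeRing ℝ-commutativeRing

module ℂ = CommutativeRing ℂ-commutativeRing

ℂ : Set
ℂ = ℂ.Carrier

module UnitGroup {c ℓ} (R : CommutativeRing c ℓ) where

  open CommutativeRing R
  open CommutativeSemigroupProperties *-commutativeSemigroup using (interchange)

  record Unit : Set (c ⊔ ℓ) where
    no-eta-equality
    constructor mkUnit
    field
      value      : Carrier
      invertible : Invertible _≈_ 1# _*_ value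

    inverse : Carrier
    inverse = proj₁ invertible

    inverseˡ : inverse * value ≈ 1#
    inverseˡ = proj₁ (proj₂ invertible)

    inverseʳ : value * inverse ≈ 1#
    inverseʳ = proj₂ (proj₂ invertible)

  open Unit public

  infix 4 _≈ᵘ_

  record _≈ᵘ_ (u v : Unit) : Set ℓ where
    constructor mk≈ᵘ
    field
      value-≈ : value u ≈ value v

  open _≈ᵘ_ public

  _*ᵘ_ : Unit → Unit → Unit
  value (u *ᵘ v) = value u * value v
  invertible (u *ᵘ v) =
    ( inverse u * inverse v
    , trans (interchange (inverse u) (inverse v) (value u) (value v))
        (trans (*-cong (inverseˡ u) (inverseˡ v)) (*-identityˡ 1#))
    , trans (interchange (value u) (value v) (inverse u) (inverse v))
        (trans (*-cong (inverseʳ u) (inverseʳ v)) (*-identityˡ 1#))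
    )

  1ᵘ : Unit
  value 1ᵘ = 1#
  invertible 1ᵘ = 1# , *-identityˡ 1# , *-identityˡ 1#

  _⁻¹ᵘ : Unit → Unit
  value (u ⁻¹ᵘ) = inverse u
  invertible (u ⁻¹ᵘ) = value u , inverseʳ u , inverseˡ u

  private
    ⁻¹ᵘ-cong : ∀ {u v} → u ≈ᵘ v → u ⁻¹ᵘ ≈ᵘ v ⁻¹ᵘ
    ⁻¹ᵘ-cong {u} {v} (mk≈ᵘ u≈v) = mk≈ᵘ (begin
      inverse u                          ≈⟨ *-identityʳ (inverse u) ⟨
      inverse u * 1#                     ≈⟨ *-congˡ (inverseʳ v) ⟨
      inverse u * (value v * inverse v)  ≈⟨ *-assoc (inverse u) (value v) (inverse v) ⟨
      inverse u * value v * inverse v    ≈⟨ *-congʳ (*-congˡ u≈v) ⟨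
      inverse u * value u * inverse v    ≈⟨ *-congʳ (inverseˡ u) ⟩
      1# * inverse v                     ≈⟨ *-identityˡ (inverse v) ⟩
      inverse v                          ∎)
      where open ≈-Reasoning setoid

  unitGroup : AbelianGroup (c ⊔ ℓ) ℓ
  unitGroup = record
    { Carrier = Unit
    ; _≈_ = _≈ᵘ_
    ; _∙_ = _*ᵘ_
    ; ε = 1ᵘ
    ; _⁻¹ = _⁻¹ᵘ
    ; isAbelianGroup = record
      { isGroup = record
        { isMonoid = record
          { isSemigroup = record
            { isMagma = record
              { isEquivalence = record
                { refl = mk≈ᵘ refl
                ; sym = λ (mk≈ᵘ p) → mk≈ᵘ (sym p)
                ; trans = λ (mk≈ᵘ p) (mk≈ᵘ q) → mk≈ᵘ (trans p q)
                }
              ; ∙-cong = λ (mk≈ᵘ p) (mk≈ᵘ q) → mk≈ᵘ (*-cong p q)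
              }
            ; assoc = λ u v w → mk≈ᵘ (*-assoc (value u) (value v) (value w))
            }
          ; identity = (λ u → mk≈ᵘ (*-identityˡ (value u)))
                     , (λ u → mk≈ᵘ (*-identityʳ (value u)))
          }
        ; inverse = (λ u → mk≈ᵘ (inverseˡ u)) , (λ u → mk≈ᵘ (inverseʳ u))
        ; ⁻¹-cong = ⁻¹ᵘ-cong
        }
      ; comm = λ u v → mk≈ᵘ (*-comm (value u) (value v))
      }
    }

module HomGroup {g ℓg a ℓa} (G : AbelianGroup g ℓg) (A : AbelianGroup a ℓa) where

  private
    module G = AbelianGroup G
    module A = AbelianGroup A
    open AbelianGroupProperties A using (⁻¹-∙-comm; ε⁻¹≈ε)
    open CommutativeSemigroupProperties A.commutativeSemigroup using (interchange)

  record Hom : Set (g ⊔ ℓg ⊔ a ⊔ ℓa) where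
    no-eta-equality
    field
      ⟦_⟧                 : G.Carrier → A.Carrier
      isGroupHomomorphism : IsGroupHomomorphism G.rawGroup A.rawGroup ⟦_⟧

  open Hom public

  private
    module H (f : Hom) = IsGroupHomomorphism (isGroupHomomorphism f)

  infix 4 _≈ʰ_

  record _≈ʰ_ (f h : Hom) : Set (g ⊔ ℓa) where
    constructor mk≈ʰ
    field
      ⟦⟧-≈ : ∀ x → ⟦ f ⟧ x A.≈ ⟦ h ⟧ x

  open _≈ʰ_ public

  private
    isHom : {f : G.Carrier → A.Carrier} →
            (∀ {x y} → x G.≈ y → f x A.≈ f y) →
            (∀ x y → f (x G.∙ y) A.≈ f x A.∙ f y) →
            f G.ε A.≈ A.ε →
            (∀ x → f (x G.⁻¹) A.≈ f x A.⁻¹) →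
            IsGroupHomomorphism G.rawGroup A.rawGroup f
    isHom f-cong f-homo f-ε f-⁻¹ = record
      { isMonoidHomomorphism = record
        { isMagmaHomomorphism = record
          { isRelHomomorphism = record { cong = f-cong }
          ; homo = f-homo
          }
        ; ε-homo = f-ε
        }
      ; ⁻¹-homo = f-⁻¹
      }

  infixl 7 _∙ʰ_

  _∙ʰ_ : Hom → Hom → Hom
  ⟦ f ∙ʰ h ⟧ x = ⟦ f ⟧ x A.∙ ⟦ h ⟧ x
  isGroupHomomorphism (f ∙ʰ h) = isHom
    (λ x≈y → A.∙-cong (H.⟦⟧-cong f x≈y) (H.⟦⟧-cong h x≈y))
    (λ x y → A.trans (A.∙-cong (H.homo f x y) (H.homo h x y))
      (interchange (⟦ f ⟧ x) (⟦ f ⟧ y) (⟦ h ⟧ x) (⟦ h ⟧ y)))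
    (A.trans (A.∙-cong (H.ε-homo f) (H.ε-homo h)) (A.identityˡ A.ε))
    (λ x → A.trans (A.∙-cong (H.⁻¹-homo f x) (H.⁻¹-homo h x))
      (⁻¹-∙-comm (⟦ f ⟧ x) (⟦ h ⟧ x)))

  εʰ : Hom
  ⟦ εʰ ⟧ _ = A.ε
  isGroupHomomorphism εʰ = isHom (λ _ → A.refl) (λ _ _ → A.sym (A.identityˡ A.ε)) A.refl
    (λ _ → A.sym ε⁻¹≈ε)

  _⁻¹ʰ : Hom → Hom
  ⟦ f ⁻¹ʰ ⟧ x = ⟦ f ⟧ x A.⁻¹
  isGroupHomomorphism (f ⁻¹ʰ) = isHom
    (λ x≈y → A.⁻¹-cong (H.⟦⟧-cong f x≈y))
    (λ x y → A.trans (A.⁻¹-cong (H.homo f x y)) (A.sym (⁻¹-∙-comm (⟦ f ⟧ x) (⟦ f ⟧ y))))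
    (A.trans (A.⁻¹-cong (H.ε-homo f)) ε⁻¹≈ε)
    (λ x → A.⁻¹-cong (H.⁻¹-homo f x))

  homGroup : AbelianGroup (g ⊔ ℓg ⊔ a ⊔ ℓa) (g ⊔ ℓa)
  homGroup = record
    { Carrier = Hom
    ; _≈_ = _≈ʰ_
    ; _∙_ = _∙ʰ_
    ; ε = εʰ
    ; _⁻¹ = _⁻¹ʰ
    ; isAbelianGroup = record
      { isGroup = record
        { isMonoid = record
          { isSemigroup = record
            { isMagma = record
              { isEquivalence = record
                { refl = mk≈ʰ λ _ → A.refl
                ; sym = λ (mk≈ʰ p) → mk≈ʰ λ x → A.sym (p x)
                ; trans = λ (mk≈ʰ p) (mk≈ʰ q) → mk≈ʰ λ x → A.trans (p x) (q x)
                }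
              ; ∙-cong = λ (mk≈ʰ p) (mk≈ʰ q) → mk≈ʰ λ x → A.∙-cong (p x) (q x)
              }
            ; assoc = λ f h k → mk≈ʰ λ x → A.assoc (⟦ f ⟧ x) (⟦ h ⟧ x) (⟦ k ⟧ x)
            }
          ; identity = (λ f → mk≈ʰ λ x → A.identityˡ (⟦ f ⟧ x))
                     , (λ f → mk≈ʰ λ x → A.identityʳ (⟦ f ⟧ x))
          }
        ; inverse = (λ f → mk≈ʰ λ x → A.inverseˡ (⟦ f ⟧ x))
                  , (λ f → mk≈ʰ λ x → A.inverseʳ (⟦ f ⟧ x))
        ; ⁻¹-cong = λ (mk≈ʰ p) → mk≈ʰ λ x → A.⁻¹-cong (p x)
        }
      ; comm = λ f h → mk≈ʰ λ x → A.comm (⟦ f ⟧ x) (⟦ h ⟧ x)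
      }
    }

record FiniteField (c ℓ : Level) : Set (suc (c ⊔ ℓ)) where
  field
    commutativeRing : CommutativeRing c ℓ

  open CommutativeRing commutativeRing public

  field
    0≉1            : ¬ 0# ≈ 1#
    ≉0⇒invertible : ∀ {x} → ¬ x ≈ 0# → Invertible _≈_ 1# _*_ x
    cardinality    : ℕ
    enumeration    : Inverse (≡.setoid (Fin cardinality)) setoid

  infix 4 _≟_

  _≟_ : ∀ x y → Dec (x ≈ y)
  _≟_ = via-injection (Inverse⇒Injection (Inverse.sym enumeration)) Fin._≟_

-- K is the ring of values of characters; it is ℂ in `ComplexCharacterSums`.

module CharacterSums {k ℓk} (K : CommutativeRing k ℓk) {c ℓ} (𝔽 : FiniteField c ℓ) where

  open FiniteField 𝔽

  private
    module K = CommutativeRing K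
    module Fˣ = UnitGroup commutativeRing
    module Kˣ = UnitGroup K
    module Hom = HomGroup Fˣ.unitGroup Kˣ.unitGroup

  -- Equality of constructive complex numbers is undecidable, so there is
  -- no total inverse with 1/0 = 0: a quotient comes with a proof that its
  -- denominator is invertible.  Inverses are unique, so the value does not
  -- depend on the proof.

  InvertibleK : K.Carrier → Set (k ⊔ ℓk)
  InvertibleK = Invertible K._≈_ K.1# K._*_

  infixl 7 _/_[_]

  _/_[_] : (z w : K.Carrier) → InvertibleK w → K.Carrier
  z / w [ w⁻¹ , _ ] = z K.* w⁻¹

  characterGroup : AbelianGroup (c ⊔ ℓ ⊔ k ⊔ ℓk) (c ⊔ ℓ ⊔ ℓk)
  characterGroup = Hom.homGroup

  open AbelianGroup characterGroup public
    using () renaming (Carrier to Character; _∙_ to _·_; _⁻¹ to conj)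

  infix 20 _⟨_⟩

  -- Extension of a character of the unit group to the field by χ(0) = 0,
  -- for the trivial character as well.

  _⟨_⟩ : Character → Carrier → K.Carrier
  χ ⟨ x ⟩ with x ≟ 0#
  ... | yes _   = K.0#
  ... | no x≉0 = Kˣ.value (Hom.⟦ χ ⟧ (Fˣ.mkUnit x (≉0⇒invertible x≉0)))

  ∏χ : ∀ {n} → Vector Character n → Character
  ∏χ = CommutativeMonoidSum.sum (AbelianGroup.commutativeMonoid characterGroup)

  ∏K : ∀ {n} → Vector K.Carrier n → K.Carrier
  ∏K = CommutativeMonoidSum.sum K.*-commutativeMonoid

  ∑𝔽 : (Carrier → K.Carrier) → K.Carrier
  ∑𝔽 f = CommutativeMonoidSum.sum K.+-commutativeMonoid
    λ (i : Fin cardinality) → f (Inverse.to enumeration i)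

  J : Character → Character → K.Carrier
  J A B = ∑𝔽 λ x → A ⟨ x ⟩ K.* B ⟨ 1# - x ⟩

  F-D : ∀ {n} (A : Character) (B : Vector Character n) (C : Character) →
        Vector Carrier n → InvertibleK (J A (C · conj A)) → K.Carrier
  F-D A B C λs J-inv =
    (K.1# / J A (C · conj A) [ J-inv ]) K.*
    ∑𝔽 λ y → A ⟨ y ⟩ K.* (C · conj A) ⟨ 1# - y ⟩ K.*
              ∏K λ i → conj (B i) ⟨ 1# - λs i * y ⟩

module ComplexCharacterSums {c ℓ} (𝔽 : FiniteField c ℓ) where

  open CharacterSums ℂ-commutativeRing 𝔽 public
    renaming (InvertibleK to Invertibleℂ; ∏K to ∏ℂ)

{-# OPTIONS --safe #-}
module Submission where

open import Defs
open import Algebra.Bundles using (CommutativeRing; AbelianGroup)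
open import Algebra.Definitions using (Invertible)
open import Algebra.Morphism.Structures using (IsGroupHomomorphism)
import Algebra.Properties.AbelianGroup as AbelianGroupProperties
import Algebra.Properties.CommutativeMonoid.Sum as CommutativeMonoidSum
import Algebra.Properties.CommutativeSemigroup as CommutativeSemigroupProperties
import Algebra.Properties.Monoid.Mult as MonoidMult
import Algebra.Properties.Ring as RingProperties
import Algebra.Properties.Semiring.Mult.TCOptimised as SemiringMult
import Algebra.Properties.Semiring.Sum as SemiringSum
import Algebra.Solver.Ring as RingSolver
open import Algebra.Solver.Ring.AlmostCommutativeRing
  using (fromCommutativeRing; _-Raw-AlmostCommutative⟶_)
open import Data.Integer.Base as ℤ using (ℤ; +_; -[1+_]; _⊖_; _◃_)
import Data.Integer.Properties as ℤ
open import Data.Fin.Base as Fin using (Fin; punchIn)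
import Data.Fin.Properties as Fin
open import Data.Maybe.Base using (Maybe; just; nothing)
open import Data.Nat.Base as ℕ using (ℕ; zero; suc; _≤_; _^_)
import Data.Nat.Properties as ℕ
open import Data.Nat.Primality using (Prime; prime⇒nonZero; prime⇒nonTrivial)
open import Data.Product.Base using (Σ-syntax; _,_; proj₁; proj₂)
open import Data.Rational.Base as ℚ using (ℚ; 0ℚ; 1ℚ)
import Data.Rational.Properties as ℚ
import Data.Sign.Base as Sign
open import Data.Vec.Functional using (Vector; removeAt)
open import Function.Base using (_∘_)
open import Function.Bundles using (Inverse)
import Function.Properties.Inverse as Inverses
open import Relation.Binary.PropositionalEquality as ≡ using (_≡_; _≢_)
import Relation.Binary.Reasoning.Setoid as ≈-Reasoning
open import Relation.Nullary using (¬_; yes; no; contradiction)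

-- Write S χ = Σ_x χ(x).  Replacing x by y s in J(A,B) J(Ā,B̄) = Σ_{x,y} A(x/y) B((1-x)/(1-y))
-- gives, for all characters A and B,
--   J(A,B) J(Ā,B̄) = q - S(AB) - S(A) - S(B) + S(A) S(B).
-- Since S(A)² = (q - 1) S(A) and S(A) S(AB) = S(A) S(B) = S(B) S(AB), the right-hand
-- side is invertible in every commutative ring in which q and q - 2 are.  Hence all Jacobi sums are
-- invertible, without deciding which characters are trivial.  The transformation itself is the
-- substitution y = z / (z - 1), which turns 1 - λ y into (1 - (1 - λ) z) / (1 - z).

-- The usual proof that Jacobi sums are nonzero sorts the pairs (A, B) by which of A, B, AB are
-- trivial and uses |J|² = q in the generic case. Equality of values in ℂ is not decidable, so the
-- cases are packed into one identity. Where S(χ) is q - 1 or 0 according as χ is trivial or not,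
-- its right-hand side is q if none of A, B, AB is trivial, 1 if exactly one is, and (q - 2)² if all
-- are; two trivial ones force the third. This is where q and q - 2 come from. The last case is J(ε,
-- ε)² = (q - 2)², which vanishes for q = 2; oddness of p enters here. Since Ā is the inverse of A
-- in the character group, no absolute value or complex conjugation is involved, and the argument
-- takes place over an arbitrary ring of values.

-- Ring solver with integer coefficients.

module IntegerCoefficients {c ℓ} (R : CommutativeRing c ℓ) where

  open CommutativeRing R
  open RingProperties ring
    using (-‿involutive; -0#≈0#; -‿distribˡ-*; -‿distribʳ-*; -‿+-comm)
  open CommutativeSemigroupProperties +-commutativeSemigroup using (interchange)
  open SemiringMult semiring using (_×_; ×-homo-+; 1+×; ×1-homo-*)
  open ≈-Reasoning setoid

  ⟦_⟧ : ℤ → Carrier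
  ⟦ + n      ⟧ = n × 1#
  ⟦ -[1+ n ] ⟧ = - (suc n × 1#)

  neg-homo : ∀ i → ⟦ ℤ.- i ⟧ ≈ - ⟦ i ⟧
  neg-homo (+ zero)  = sym -0#≈0#
  neg-homo (+ suc n) = refl
  neg-homo -[1+ n ]  = sym (-‿involutive (suc n × 1#))

  ⊖-homo : ∀ m n → ⟦ m ⊖ n ⟧ ≈ m × 1# - n × 1#
  ⊖-homo m       zero    = sym (trans (+-congˡ -0#≈0#) (+-identityʳ (m × 1#)))
  ⊖-homo zero    (suc n) = sym (+-identityˡ (- (suc n × 1#)))
  ⊖-homo (suc m) (suc n) = begin
    ⟦ suc m ⊖ suc n ⟧                  ≡⟨ ≡.cong ⟦_⟧ (ℤ.[1+m]⊖[1+n]≡m⊖n m n) ⟩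
    ⟦ m ⊖ n ⟧                          ≈⟨ ⊖-homo m n ⟩
    m × 1# - n × 1#                    ≈⟨ +-identityˡ _ ⟨
    0# + (m × 1# - n × 1#)             ≈⟨ +-congʳ (-‿inverseʳ 1#) ⟨
    (1# - 1#) + (m × 1# - n × 1#)      ≈⟨ interchange 1# (- 1#) (m × 1#) (- (n × 1#)) ⟩
    (1# + m × 1#) + (- 1# - n × 1#)    ≈⟨ +-congˡ (-‿+-comm 1# (n × 1#)) ⟩
    (1# + m × 1#) - (1# + n × 1#)      ≈⟨ +-cong (1+× m 1#) (-‿cong (1+× n 1#)) ⟨
    suc m × 1# - suc n × 1#            ∎

  +-homo : ∀ i j → ⟦ i ℤ.+ j ⟧ ≈ ⟦ i ⟧ + ⟦ j ⟧
  +-homo (+ m)    (+ n)    = ×-homo-+ 1# m n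
  +-homo (+ m)    -[1+ n ] = ⊖-homo m (suc n)
  +-homo -[1+ m ] (+ n)    = trans (⊖-homo n (suc m)) (+-comm (n × 1#) (- (suc m × 1#)))
  +-homo -[1+ m ] -[1+ n ] = begin
    - (suc (suc (m ℕ.+ n)) × 1#)       ≡⟨ ≡.cong (λ t → - (suc t × 1#)) (ℕ.+-suc m n) ⟨
    - ((suc m ℕ.+ suc n) × 1#)         ≈⟨ -‿cong (×-homo-+ 1# (suc m) (suc n)) ⟩
    - (suc m × 1# + suc n × 1#)        ≈⟨ -‿+-comm (suc m × 1#) (suc n × 1#) ⟨
    - (suc m × 1#) - suc n × 1#        ∎

  +◃-homo : ∀ n → ⟦ Sign.+ ◃ n ⟧ ≈ n × 1#
  +◃-homo n = reflexive (≡.cong ⟦_⟧ (ℤ.+◃n≡+n n))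

  -◃-homo : ∀ n → ⟦ Sign.- ◃ n ⟧ ≈ - (n × 1#)
  -◃-homo n = trans (reflexive (≡.cong ⟦_⟧ (ℤ.-◃n≡-n n))) (neg-homo (+ n))

  *-homo : ∀ i j → ⟦ i ℤ.* j ⟧ ≈ ⟦ i ⟧ * ⟦ j ⟧
  *-homo (+ m) (+ n) = trans (+◃-homo (m ℕ.* n)) (×1-homo-* m n)
  *-homo (+ m) -[1+ n ] = begin
    ⟦ Sign.- ◃ (m ℕ.* suc n) ⟧         ≈⟨ -◃-homo (m ℕ.* suc n) ⟩
    - ((m ℕ.* suc n) × 1#)             ≈⟨ -‿cong (×1-homo-* m (suc n)) ⟩
    - (m × 1# * suc n × 1#)            ≈⟨ -‿distribʳ-* (m × 1#) (suc n × 1#) ⟩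
    m × 1# * - (suc n × 1#)            ∎
  *-homo -[1+ m ] (+ n) = begin
    ⟦ Sign.- ◃ (suc m ℕ.* n) ⟧         ≈⟨ -◃-homo (suc m ℕ.* n) ⟩
    - ((suc m ℕ.* n) × 1#)             ≈⟨ -‿cong (×1-homo-* (suc m) n) ⟩
    - (suc m × 1# * n × 1#)            ≈⟨ -‿distribˡ-* (suc m × 1#) (n × 1#) ⟩
    - (suc m × 1#) * n × 1#            ∎
  *-homo -[1+ m ] -[1+ n ] = begin
    (suc m ℕ.* suc n) × 1#             ≈⟨ ×1-homo-* (suc m) (suc n) ⟩
    suc m × 1# * suc n × 1#            ≈⟨ -‿involutive _ ⟨
    - - (suc m × 1# * suc n × 1#)      ≈⟨ -‿cong (-‿distribʳ-* (suc m × 1#) (suc n × 1#)) ⟩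
    - (suc m × 1# * - (suc n × 1#))    ≈⟨ -‿distribˡ-* (suc m × 1#) (- (suc n × 1#)) ⟩
    - (suc m × 1#) * - (suc n × 1#)    ∎

  homomorphism : ℤ.+-*-rawRing -Raw-AlmostCommutative⟶ fromCommutativeRing R
  homomorphism = record
    { ⟦_⟧    = ⟦_⟧
    ; +-homo = +-homo
    ; *-homo = *-homo
    ; -‿homo = neg-homo
    ; 0-homo = refl
    ; 1-homo = refl
    }

  -- Only integers are compared: `nothing` is harmless where distinct integers have equal images, so
  -- the solver serves rings without decidable equality and of any characteristic.
  coeff≟ : ∀ i j → Maybe (⟦ i ⟧ ≈ ⟦ j ⟧)
  coeff≟ i j with i ℤ.≟ j
  ... | yes i≡j = just (reflexive (≡.cong ⟦_⟧ i≡j))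
  ... | no _    = nothing

  open RingSolver _ (fromCommutativeRing R) homomorphism coeff≟ public
    using (solve; con; _:=_; _:+_; _:*_; _:-_; :-_)

-- Total inversion and bijections of the finite field.

module FieldProperties {c ℓ} (𝔽 : FiniteField c ℓ) where

  open FiniteField 𝔽
  open IntegerCoefficients commutativeRing using (solve; con; _:=_; _:+_; _:*_; _:-_)
  open ≈-Reasoning setoid

  infix 8 _⁻¹

  -- The default `0#` at zero makes inversion an involution of the whole field, hence a legitimate
  -- substitution in `∑𝔽`. It also matches χ(0) = 0 in `⟨⟩-⁻¹`.
  _⁻¹ : Carrier → Carrier
  x ⁻¹ with x ≟ 0#
  ... | yes _  = 0#
  ... | no x≉0 = proj₁ (≉0⇒invertible x≉0)

  ⁻¹-zero : ∀ {x} → x ≈ 0# → x ⁻¹ ≈ 0#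
  ⁻¹-zero {x} x≈0 with x ≟ 0#
  ... | yes _  = refl
  ... | no x≉0 = contradiction x≈0 x≉0

  ⁻¹-inverseˡ : ∀ {x} → ¬ x ≈ 0# → x ⁻¹ * x ≈ 1#
  ⁻¹-inverseˡ {x} x≉0 with x ≟ 0#
  ... | yes x≈0 = contradiction x≈0 x≉0
  ... | no x≉0′ = proj₁ (proj₂ (≉0⇒invertible x≉0′))

  ⁻¹-inverseʳ : ∀ {x} → ¬ x ≈ 0# → x * x ⁻¹ ≈ 1#
  ⁻¹-inverseʳ {x} x≉0 = trans (*-comm x (x ⁻¹)) (⁻¹-inverseˡ x≉0)

  x*y≈1⇒x≉0 : ∀ {x y} → x * y ≈ 1# → ¬ x ≈ 0#
  x*y≈1⇒x≉0 {x} {y} xy≈1 x≈0 = 0≉1 (trans (sym (zeroˡ y)) (trans (*-congʳ (sym x≈0)) xy≈1))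

  ⁻¹-unique : ∀ {x y} → x * y ≈ 1# → x ⁻¹ ≈ y
  ⁻¹-unique {x} {y} xy≈1 = begin
    x ⁻¹            ≈⟨ *-identityʳ (x ⁻¹) ⟨
    x ⁻¹ * 1#       ≈⟨ *-congˡ xy≈1 ⟨
    x ⁻¹ * (x * y)  ≈⟨ *-assoc (x ⁻¹) x y ⟨
    x ⁻¹ * x * y    ≈⟨ *-congʳ (⁻¹-inverseˡ (x*y≈1⇒x≉0 xy≈1)) ⟩
    1# * y          ≈⟨ *-identityˡ y ⟩
    y               ∎

  -- The inverses supplied by the field may depend on the representative and on the proof that it is
  -- nonzero; uniqueness of inverses removes this dependence.
  ⁻¹-cong : ∀ {x y} → x ≈ y → x ⁻¹ ≈ y ⁻¹
  ⁻¹-cong {x} {y} x≈y with y ≟ 0#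
  ... | yes y≈0 = ⁻¹-zero (trans x≈y y≈0)
  ... | no  y≉0 = ⁻¹-unique (trans (*-congʳ x≈y) (proj₂ (proj₂ (≉0⇒invertible y≉0))))

  ⁻¹-involutive : ∀ x → x ⁻¹ ⁻¹ ≈ x
  ⁻¹-involutive x with x ≟ 0#
  ... | yes x≈0 = trans (⁻¹-zero refl) (sym x≈0)
  ... | no  x≉0 = ⁻¹-unique (proj₁ (proj₂ (≉0⇒invertible x≉0)))

  x-y≈0⇒x≈y : ∀ {x y} → x - y ≈ 0# → x ≈ y
  x-y≈0⇒x≈y {x} {y} x-y≈0 = begin
    x          ≈⟨ solve 2 (λ a b → a := a :- b :+ b) refl x y ⟩
    x - y + y  ≈⟨ +-congʳ x-y≈0 ⟩
    0# + y     ≈⟨ +-identityˡ y ⟩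
    y          ∎

  x≈y⇒x-y≈0 : ∀ {x y} → x ≈ y → x - y ≈ 0#
  x≈y⇒x-y≈0 {x} {y} x≈y = trans (+-congʳ x≈y) (-‿inverseʳ y)

  x-0≈x : ∀ x → x - 0# ≈ x
  x-0≈x = solve 1 (λ x → x :- con (+ 0) := x) refl

  1-[1-x]≈x : ∀ x → 1# - (1# - x) ≈ x
  1-[1-x]≈x = solve 1 (λ x → con (+ 1) :- (con (+ 1) :- x) := x) refl

  involution : (f : Carrier → Carrier) → (∀ {x y} → x ≈ y → f x ≈ f y) →
               (∀ x → f (f x) ≈ x) → Inverse setoid setoid
  involution f f-cong f-involutive = record
    { to        = f
    ; from      = f
    ; to-cong   = f-cong
    ; from-cong = f-cong
    ; inverse   = (λ {x} y≈fx → trans (f-cong y≈fx) (f-involutive x))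
                , (λ {x} y≈fx → trans (f-cong y≈fx) (f-involutive x))
    }

  reflection : Inverse setoid setoid
  reflection = involution (λ x → 1# - x) (λ x≈y → +-congˡ (-‿cong x≈y)) 1-[1-x]≈x

  reciprocal : Inverse setoid setoid
  reciprocal = involution _⁻¹ ⁻¹-cong ⁻¹-involutive

  scaling : ∀ a → ¬ a ≈ 0# → Inverse setoid setoid
  scaling a a≉0 = record
    { to        = a *_
    ; from      = a ⁻¹ *_
    ; to-cong   = *-congˡ
    ; from-cong = *-congˡ
    ; inverse   = (λ {x} y≈ → trans (*-congˡ y≈) (cancel (⁻¹-inverseʳ a≉0) x))
                , (λ {x} y≈ → trans (*-congˡ y≈) (cancel (⁻¹-inverseˡ a≉0) x))
    }
    where
    cancel : ∀ {u v} → u * v ≈ 1# → ∀ x → u * (v * x) ≈ x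
    cancel {u} {v} uv≈1 x = trans (sym (*-assoc u v x)) (trans (*-congʳ uv≈1) (*-identityˡ x))

  translation : Carrier → Inverse setoid setoid
  translation a = record
    { to        = _+ a
    ; from      = _- a
    ; to-cong   = +-congʳ
    ; from-cong = +-congʳ
    ; inverse   = (λ {x} y≈ → trans (+-congʳ y≈) (solve 2 (λ x a → x :- a :+ a := x) refl x a))
                , (λ {x} y≈ → trans (+-congʳ y≈) (solve 2 (λ x a → x :+ a :- a := x) refl x a))
    }

-- Invertibility in a commutative ring.

module InvertibilityLemmas {c ℓ} (R : CommutativeRing c ℓ) where

  open CommutativeRing R
  open IntegerCoefficients R using (solve; con; _:=_; _:+_; _:*_; _:-_)
  open ≈-Reasoning setoid

  InvertibleR : Carrier → Set _
  InvertibleR = Invertible _≈_ 1# _*_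

  invertible : ∀ {x y} → x * y ≈ 1# → InvertibleR x
  invertible {x} {y} xy≈1 = y , trans (*-comm y x) xy≈1 , xy≈1

  invertible-cong : ∀ {x y} → x ≈ y → InvertibleR x → InvertibleR y
  invertible-cong x≈y (z , _ , xz≈1) = invertible (trans (*-congʳ (sym x≈y)) xz≈1)

  invertible-factorʳ : ∀ x {y} → InvertibleR (x * y) → InvertibleR y
  invertible-factorʳ x {y} (z , _ , xyz≈1) = invertible (begin
    y * (x * z)  ≈⟨ solve 3 (λ x y z → y :* (x :* z) := x :* y :* z) refl x y z ⟩
    x * y * z    ≈⟨ xyz≈1 ⟩
    1#           ∎)

  -- If m is invertible, a / m, b / m and c / m are idempotents any two of which have
  -- the same product, and splitting R along them gives the inverse of N; m drops out.
  invertible-product : ∀ {a b c r N} → let m = 1# + r; q = 1# + m in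
    a * a ≈ a * m → b * b ≈ b * m → c * c ≈ c * m →
    a * c ≈ a * b → b * c ≈ a * b →
    N + (c + a + b) ≈ q + a * b →
    InvertibleR q → InvertibleR r → InvertibleR N
  invertible-product {a} {b} {c} {r} {N} aa bb cc ac bc N-eq (q′ , q′q , _) (r′ , _ , rr′) =
    invertible (begin
      -- The witness comes from interpolation: N is q where a, b, c vanish, 1 where exactly one of
      -- them is m, and r² where all are m. The term a + b + c adjusts q′ to q′ (1 + m) = 1 in the
      -- second case. The third case requires 1 + 3 m + w m² = q / r², whose solution is w = (2 - 3
      -- r) / r², the factor m² cancelling.
      N * (q′ * (1# + (a + b + c) + w * (a * b)))
        ≈⟨ solve 7 (λ N q′ a b c w P → N :* (q′ :* (con (+ 1) :+ (a :+ b :+ c) :+ w :* P))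
                     := q′ :* (N :+ (N :* a :+ N :* b :+ N :* c) :+ w :* (N :* P)))
             refl N q′ a b c w (a * b) ⟩
      q′ * (N + (N * a + N * b + N * c) + w * (N * (a * b)))
        ≈⟨ *-congˡ (+-cong (+-cong N≈ (+-cong (+-cong Na Nb) Nc)) (*-congˡ Nab)) ⟩
      q′ * ((q + a * b - (c + a + b)) +
        ((a + (r - 1#) * (a * b)) + (b + (r - 1#) * (a * b)) + (c + (r - 1#) * (a * b))) +
        w * (r * r * (a * b)))
        ≈⟨ solve 6 (λ a b c r q′ r′ →
             let one = con (+ 1)
                 two = con (+ 2)
                 three = con (+ 3)
                 P = a :* b
                 q = one :+ (one :+ r) in
             q′ :* ((q :+ P :- (c :+ a :+ b)) :+
               ((a :+ (r :- one) :* P) :+ (b :+ (r :- one) :* P) :+ (c :+ (r :- one) :* P)) :+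
               (two :* (r′ :* r′) :- three :* r′) :* (r :* r :* P))
             := q′ :* q :+ q′ :* P :*
                  (three :* r :- two :+ two :* ((r :* r′) :* (r :* r′)) :- three :* r :* (r :* r′)))
             refl a b c r q′ r′ ⟩
      q′ * q + q′ * (a * b) * (3# * r - 2# + 2# * ((r * r′) * (r * r′)) - 3# * r * (r * r′))
        ≈⟨ +-cong q′q (*-congˡ (+-cong (+-congˡ (*-congˡ (*-cong rr′ rr′))) (-‿cong (*-congˡ rr′)))) ⟩
      1# + q′ * (a * b) * (3# * r - 2# + 2# * (1# * 1#) - 3# * r * 1#)
        ≈⟨ solve 2 (λ r t → let one = con (+ 1); two = con (+ 2); three = con (+ 3) in
             one :+ t :* (three :* r :- two :+ two :* (one :* one) :- three :* r :* one) := one)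
             refl r (q′ * (a * b)) ⟩
      1# ∎)
    where
    2# 3# m q w : Carrier
    2# = 1# + 1#
    3# = 1# + 1# + 1#
    m = 1# + r
    q = 1# + m
    w = 2# * (r′ * r′) - 3# * r′

    N≈ : N ≈ q + a * b - (c + a + b)
    N≈ = begin
      N                                ≈⟨ solve 2 (λ N s → N := N :+ s :- s) refl N (c + a + b) ⟩
      N + (c + a + b) - (c + a + b)    ≈⟨ +-congʳ N-eq ⟩
      q + a * b - (c + a + b)          ∎

    -- In terms of the idempotents, N acts on `a` as 1 where b and c vanish and as r² where all
    -- three are m; there r² m = m + (r - 1) m².
    Na : N * a ≈ a + (r - 1#) * (a * b)
    Na = begin
      N * a
        ≈⟨ *-congʳ N≈ ⟩
      (q + a * b - (c + a + b)) * a
        ≈⟨ solve 4 (λ a b c q → (q :+ a :* b :- (c :+ a :+ b)) :* a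
                     := q :* a :+ (a :* a) :* b :- a :* c :- a :* a :- a :* b) refl a b c q ⟩
      q * a + (a * a) * b - a * c - a * a - a * b
        ≈⟨ +-congʳ (+-cong (+-cong (+-congˡ (*-congʳ aa)) (-‿cong ac)) (-‿cong aa)) ⟩
      q * a + (a * m) * b - a * b - a * m - a * b
        ≈⟨ solve 3 (λ a b r → let one = con (+ 1); m = one :+ r in
             (one :+ m) :* a :+ (a :* m) :* b :- a :* b :- a :* m :- a :* b
             := a :+ (r :- one) :* (a :* b)) refl a b r ⟩
      a + (r - 1#) * (a * b) ∎

    Nb : N * b ≈ b + (r - 1#) * (a * b)
    Nb = begin
      N * b
        ≈⟨ *-congʳ N≈ ⟩
      (q + a * b - (c + a + b)) * b
        ≈⟨ solve 4 (λ a b c q → (q :+ a :* b :- (c :+ a :+ b)) :* b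
                     := q :* b :+ a :* (b :* b) :- b :* c :- b :* b :- a :* b) refl a b c q ⟩
      q * b + a * (b * b) - b * c - b * b - a * b
        ≈⟨ +-congʳ (+-cong (+-cong (+-congˡ (*-congˡ bb)) (-‿cong bc)) (-‿cong bb)) ⟩
      q * b + a * (b * m) - a * b - b * m - a * b
        ≈⟨ solve 3 (λ a b r → let one = con (+ 1); m = one :+ r in
             (one :+ m) :* b :+ a :* (b :* m) :- a :* b :- b :* m :- a :* b
             := b :+ (r :- one) :* (a :* b)) refl a b r ⟩
      b + (r - 1#) * (a * b) ∎

    Nc : N * c ≈ c + (r - 1#) * (a * b)
    Nc = begin
      N * c
        ≈⟨ *-congʳ N≈ ⟩
      (q + a * b - (c + a + b)) * c
        ≈⟨ solve 4 (λ a b c q → (q :+ a :* b :- (c :+ a :+ b)) :* c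
                     := q :* c :+ a :* (b :* c) :- c :* c :- a :* c :- b :* c) refl a b c q ⟩
      q * c + a * (b * c) - c * c - a * c - b * c
        ≈⟨ +-cong (+-cong (+-cong (+-congˡ abc) (-‿cong cc)) (-‿cong ac)) (-‿cong bc) ⟩
      q * c + (a * m) * b - c * m - a * b - a * b
        ≈⟨ solve 4 (λ a b c r → let one = con (+ 1); m = one :+ r in
             (one :+ m) :* c :+ (a :* m) :* b :- c :* m :- a :* b :- a :* b
             := c :+ (r :- one) :* (a :* b)) refl a b c r ⟩
      c + (r - 1#) * (a * b) ∎
      where
      abc : a * (b * c) ≈ (a * m) * b
      abc = trans (*-congˡ bc) (trans (sym (*-assoc a a b)) (*-congʳ aa))

    Nab : N * (a * b) ≈ r * r * (a * b)
    Nab = begin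
      N * (a * b)
        ≈⟨ *-assoc N a b ⟨
      N * a * b
        ≈⟨ *-congʳ Na ⟩
      (a + (r - 1#) * (a * b)) * b
        ≈⟨ solve 3 (λ a b r → let one = con (+ 1) in
             (a :+ (r :- one) :* (a :* b)) :* b
             := a :* b :+ (r :- one) :* (a :* (b :* b))) refl a b r ⟩
      a * b + (r - 1#) * (a * (b * b))
        ≈⟨ +-congˡ (*-congˡ (*-congˡ bb)) ⟩
      a * b + (r - 1#) * (a * (b * m))
        ≈⟨ solve 3 (λ a b r → let one = con (+ 1) in
             a :* b :+ (r :- one) :* (a :* (b :* (one :+ r)))
             := r :* r :* (a :* b)) refl a b r ⟩
      r * r * (a * b) ∎

-- Characters extended by zero.

module CharacterProperties {k ℓk} (K : CommutativeRing k ℓk) {c ℓ} (𝔽 : FiniteField c ℓ) where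

  open FiniteField 𝔽
  open FieldProperties 𝔽
  open CharacterSums K 𝔽

  private
    module K = CommutativeRing K
    module Fˣ = UnitGroup commutativeRing
    module Kˣ = UnitGroup K
    module Hom = HomGroup Fˣ.unitGroup Kˣ.unitGroup
    module Ĝ = AbelianGroup characterGroup
    module H (χ : Character) = IsGroupHomomorphism (Hom.isGroupHomomorphism χ)

  -- As a function, the case distinction leaves every `χ ⟨ x ⟩` in the goal folded; a `with` would
  -- unfold them.
  zero-or-not : ∀ {a} {P : Set a} x → (x ≈ 0# → P) → (¬ x ≈ 0# → P) → P
  zero-or-not x if-zero if-nonzero with x ≟ 0#
  ... | yes x≈0 = if-zero x≈0
  ... | no  x≉0 = if-nonzero x≉0

  unit : ∀ {x} → ¬ x ≈ 0# → Fˣ.Unit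
  unit {x} x≉0 = Fˣ.mkUnit x (x ⁻¹ , ⁻¹-inverseˡ x≉0 , ⁻¹-inverseʳ x≉0)

  ⟨⟩-zero : ∀ χ {x} → x ≈ 0# → χ ⟨ x ⟩ K.≈ K.0#
  ⟨⟩-zero χ {x} x≈0 with x ≟ 0#
  ... | yes _   = K.refl
  ... | no  x≉0 = contradiction x≈0 x≉0

  -- `≈ᵘ` compares values only, so `χ ⟨ x ⟩` can be computed at any unit over `x`, for instance a
  -- product or an inverse of units, and not just at the one chosen in the extension by zero.
  ⟨⟩-unit : ∀ χ {x} u → x ≈ Fˣ.value u → χ ⟨ x ⟩ K.≈ Kˣ.value (Hom.⟦ χ ⟧ u)
  ⟨⟩-unit χ {x} u x≈u with x ≟ 0#
  ... | yes x≈0 = contradiction (trans (sym x≈u) x≈0) (x*y≈1⇒x≉0 (Fˣ.inverseʳ u))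
  ... | no  _   = Kˣ.value-≈ (H.⟦⟧-cong χ (Fˣ.mk≈ᵘ x≈u))

  ⟨⟩-cong : ∀ χ {x y} → x ≈ y → χ ⟨ x ⟩ K.≈ χ ⟨ y ⟩
  ⟨⟩-cong χ {x} {y} x≈y = zero-or-not y
    (λ y≈0 → K.trans (⟨⟩-zero χ (trans x≈y y≈0)) (K.sym (⟨⟩-zero χ y≈0)))
    (λ y≉0 → K.trans (⟨⟩-unit χ (unit y≉0) x≈y) (K.sym (⟨⟩-unit χ (unit y≉0) refl)))

  ⟨⟩-congˡ : ∀ {χ ψ} → χ Ĝ.≈ ψ → ∀ x → χ ⟨ x ⟩ K.≈ ψ ⟨ x ⟩
  ⟨⟩-congˡ {χ} {ψ} χ≈ψ x = zero-or-not x
    (λ x≈0 → K.trans (⟨⟩-zero χ x≈0) (K.sym (⟨⟩-zero ψ x≈0)))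
    (λ x≉0 → let u = unit x≉0 in
      K.trans (⟨⟩-unit χ u refl)
        (K.trans (Kˣ.value-≈ (Hom.⟦⟧-≈ χ≈ψ u)) (K.sym (⟨⟩-unit ψ u refl))))

  ⟨⟩-1 : ∀ χ → χ ⟨ 1# ⟩ K.≈ K.1#
  ⟨⟩-1 χ = K.trans (⟨⟩-unit χ Fˣ.1ᵘ refl) (Kˣ.value-≈ (H.ε-homo χ))

  ⟨⟩-* : ∀ χ x y → χ ⟨ x * y ⟩ K.≈ χ ⟨ x ⟩ K.* χ ⟨ y ⟩
  ⟨⟩-* χ x y = zero-or-not x
    (λ x≈0 → K.trans (⟨⟩-zero χ (trans (*-congʳ x≈0) (zeroˡ y)))
      (K.sym (K.trans (K.*-congʳ (⟨⟩-zero χ x≈0)) (K.zeroˡ _))))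
    (λ x≉0 → zero-or-not y
      (λ y≈0 → K.trans (⟨⟩-zero χ (trans (*-congˡ y≈0) (zeroʳ x)))
        (K.sym (K.trans (K.*-congˡ (⟨⟩-zero χ y≈0)) (K.zeroʳ _))))
      (λ y≉0 → let u = unit x≉0; v = unit y≉0 in
        K.trans (⟨⟩-unit χ (u Fˣ.*ᵘ v) refl)
          (K.trans (Kˣ.value-≈ (H.homo χ u v))
            (K.sym (K.*-cong (⟨⟩-unit χ u refl) (⟨⟩-unit χ v refl))))))

  ⟨⟩-· : ∀ χ ψ x → (χ · ψ) ⟨ x ⟩ K.≈ χ ⟨ x ⟩ K.* ψ ⟨ x ⟩
  ⟨⟩-· χ ψ x = zero-or-not x
    (λ x≈0 → K.trans (⟨⟩-zero (χ · ψ) x≈0)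
      (K.sym (K.trans (K.*-congʳ (⟨⟩-zero χ x≈0)) (K.zeroˡ _))))
    (λ x≉0 → let u = unit x≉0 in
      K.trans (⟨⟩-unit (χ · ψ) u refl)
        (K.sym (K.*-cong (⟨⟩-unit χ u refl) (⟨⟩-unit ψ u refl))))

  ⟨⟩-ε : ∀ {x} → ¬ x ≈ 0# → Ĝ.ε ⟨ x ⟩ K.≈ K.1#
  ⟨⟩-ε x≉0 = ⟨⟩-unit Ĝ.ε (unit x≉0) refl

  ⟨⟩-⁻¹ : ∀ χ x → χ ⟨ x ⁻¹ ⟩ K.≈ conj χ ⟨ x ⟩
  ⟨⟩-⁻¹ χ x = zero-or-not x
    (λ x≈0 → K.trans (⟨⟩-zero χ (⁻¹-zero x≈0)) (K.sym (⟨⟩-zero (conj χ) x≈0)))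
    (λ x≉0 → let u = unit x≉0 in
      K.trans (⟨⟩-unit χ (u Fˣ.⁻¹ᵘ) refl)
        (K.trans (Kˣ.value-≈ (H.⁻¹-homo χ u)) (K.sym (⟨⟩-unit (conj χ) u refl))))

  ⟨⟩-conj : ∀ χ x → conj χ ⟨ x ⟩ K.* χ ⟨ x ⟩ K.≈ Ĝ.ε ⟨ x ⟩
  ⟨⟩-conj χ x = K.trans (K.sym (⟨⟩-· (conj χ) χ x)) (⟨⟩-congˡ (Ĝ.inverseˡ χ) x)

  ⟨⟩-absorbʳ : ∀ χ x → χ ⟨ x ⟩ K.* Ĝ.ε ⟨ x ⟩ K.≈ χ ⟨ x ⟩
  ⟨⟩-absorbʳ χ x = K.trans (K.sym (⟨⟩-· χ Ĝ.ε x)) (⟨⟩-congˡ (Ĝ.identityʳ χ) x)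

  -- The point 0 must be left out because of n = 0: there the empty product of characters has value
  -- 0, the empty product in K has value 1.
  ⟨⟩-∏ : ∀ {n} (χ : Vector Character n) {x} → ¬ x ≈ 0# →
         ∏χ χ ⟨ x ⟩ K.≈ ∏K λ i → χ i ⟨ x ⟩
  ⟨⟩-∏ {zero}  χ     x≉0 = ⟨⟩-ε x≉0
  ⟨⟩-∏ {suc n} χ {x} x≉0 =
    K.trans (⟨⟩-· (χ Fin.zero) (∏χ (χ ∘ Fin.suc)) x) (K.*-congˡ (⟨⟩-∏ (χ ∘ Fin.suc) x≉0))

  -- Sums over the field.

  private
    module ∑ = CommutativeMonoidSum K.+-commutativeMonoid

    Respects : (Carrier → K.Carrier) → Set _
    Respects f = ∀ {x y} → x ≈ y → f x K.≈ f y

  ∑𝔽-cong : ∀ {f g} → (∀ x → f x K.≈ g x) → ∑𝔽 f K.≈ ∑𝔽 g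
  ∑𝔽-cong f≈g = ∑.sum-cong-≋ (λ i → f≈g (Inverse.to enumeration i))

  ∑𝔽-zero : ∀ {f} → (∀ x → f x K.≈ K.0#) → ∑𝔽 f K.≈ K.0#
  ∑𝔽-zero f≈0 = K.trans (∑𝔽-cong f≈0) (∑.sum-replicate-zero cardinality)

  ∑𝔽-distrib-+ : ∀ f g → ∑𝔽 (λ x → f x K.+ g x) K.≈ ∑𝔽 f K.+ ∑𝔽 g
  ∑𝔽-distrib-+ f g =
    ∑.∑-distrib-+ (f ∘ Inverse.to enumeration) (g ∘ Inverse.to enumeration)

  ∑𝔽-comm : (f : Carrier → Carrier → K.Carrier) →
             (∑𝔽 λ x → ∑𝔽 λ y → f x y) K.≈ (∑𝔽 λ y → ∑𝔽 λ x → f x y)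
  ∑𝔽-comm f = ∑.∑-comm {cardinality} {cardinality}
    (λ i j → f (Inverse.to enumeration i) (Inverse.to enumeration j))

  *-distribˡ-∑𝔽 : ∀ a f → a K.* ∑𝔽 f K.≈ ∑𝔽 λ x → a K.* f x
  *-distribˡ-∑𝔽 a f = SemiringSum.*-distribˡ-sum K.semiring a (f ∘ Inverse.to enumeration)

  *-distribʳ-∑𝔽 : ∀ a f → ∑𝔽 f K.* a K.≈ ∑𝔽 λ x → f x K.* a
  *-distribʳ-∑𝔽 a f = SemiringSum.*-distribʳ-sum K.semiring a (f ∘ Inverse.to enumeration)

  -- Conjugating σ by the enumeration gives a permutation of the indices. The round trip through an
  -- index returns each point only up to `≈`, hence the hypothesis on `f`.
  ∑𝔽-substitute : (σ : Inverse setoid setoid) → ∀ {f} → Respects f →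
                  ∑𝔽 f K.≈ ∑𝔽 (f ∘ Inverse.to σ)
  ∑𝔽-substitute σ {f} f-cong = K.trans
    (∑.sum-permute (f ∘ Inverse.to enumeration)
      (Inverses.trans (Inverses.trans enumeration σ) (Inverses.sym enumeration)))
    (∑.sum-cong-≋ λ i → f-cong
      (Inverse.strictlyInverseˡ enumeration (Inverse.to σ (Inverse.to enumeration i))))

  -- `ε ⟨ x - a ⟩` is the indicator of x ≠ a, so a punctured sum is again a sum over the whole field
  -- and open to substitution. The enumeration meets the class of `a` at exactly one index.
  ∑𝔽-puncture : ∀ a {f} → Respects f →
                ∑𝔽 f K.≈ f a K.+ ∑𝔽 λ x → Ĝ.ε ⟨ x - a ⟩ K.* f x
  ∑𝔽-puncture a {f} f-cong = remove cardinality enumeration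
    where
    open ≈-Reasoning K.setoid

    -- The number of elements becomes a variable so that it can be matched as a successor.
    remove : ∀ n (e : Inverse (≡.setoid (Fin n)) setoid) →
             ∑.sum (f ∘ Inverse.to e) K.≈
             f a K.+ ∑.sum λ i → Ĝ.ε ⟨ Inverse.to e i - a ⟩ K.* f (Inverse.to e i)
    remove zero    e with () ← Inverse.from e a
    remove (suc n) e = begin
      ∑.sum (f ∘ to)                         ≈⟨ ∑.sum-remove (f ∘ to) ⟩
      f (to i) K.+ ∑.sum (removeAt (f ∘ to) i)
        ≈⟨ K.+-cong (f-cong to-i) (∑.sum-cong-≋ λ j → K.sym (K.trans
             (K.*-congʳ (⟨⟩-ε (others j))) (K.*-identityˡ _))) ⟩
      f a K.+ ∑.sum (removeAt g i)           ≈⟨ K.+-congˡ (K.+-identityˡ _) ⟨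
      f a K.+ (K.0# K.+ ∑.sum (removeAt g i))
        ≈⟨ K.+-congˡ (K.+-congʳ (K.trans
             (K.*-congʳ (⟨⟩-zero Ĝ.ε (x≈y⇒x-y≈0 to-i))) (K.zeroˡ _))) ⟨
      f a K.+ (g i K.+ ∑.sum (removeAt g i)) ≈⟨ K.+-congˡ (∑.sum-remove g) ⟨
      f a K.+ ∑.sum g                        ∎
      where
      open Inverse e using (to; from; strictlyInverseˡ; strictlyInverseʳ; from-cong)
      i : Fin (suc n)
      i = from a
      to-i : to i ≈ a
      to-i = strictlyInverseˡ a
      g : Fin (suc n) → K.Carrier
      g j = Ĝ.ε ⟨ to j - a ⟩ K.* f (to j)
      others : ∀ j → ¬ to (punchIn i j) - a ≈ 0#
      others j eq = Fin.punchInᵢ≢i i j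
        (≡.trans (≡.sym (strictlyInverseʳ (punchIn i j))) (from-cong (x-y≈0⇒x≈y eq)))

  -- Character sums and the product of two Jacobi sums.

  private
    module KS = IntegerCoefficients K
    module FS = IntegerCoefficients commutativeRing
    open MonoidMult K.+-monoid using () renaming (_×_ to _K×_)

  S : Character → K.Carrier
  S χ = ∑𝔽 λ x → χ ⟨ x ⟩

  S-cong : ∀ {χ ψ} → χ Ĝ.≈ ψ → S χ K.≈ S ψ
  S-cong χ≈ψ = ∑𝔽-cong (⟨⟩-congˡ χ≈ψ)

  q : K.Carrier
  q = ∑𝔽 λ _ → K.1#

  q≈1+Sε : q K.≈ K.1# K.+ S Ĝ.ε
  q≈1+Sε = K.trans (∑𝔽-puncture 0# (λ _ → K.refl))
    (K.+-congˡ (∑𝔽-cong λ x → K.trans (K.*-identityʳ _) (⟨⟩-cong Ĝ.ε (x-0≈x x))))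

  -- Multiplication by x ≠ 0 permutes the field. This is orthogonality before any case distinction:
  -- instead of S(χ) = 0 for nontrivial χ, it keeps the relation that S(χ) is annihilated by χ(x) -
  -- 1.
  ⟨⟩*S : ∀ χ x → χ ⟨ x ⟩ K.* S χ K.≈ Ĝ.ε ⟨ x ⟩ K.* S χ
  ⟨⟩*S χ x = zero-or-not x
    (λ x≈0 → K.*-congʳ (K.trans (⟨⟩-zero χ x≈0) (K.sym (⟨⟩-zero Ĝ.ε x≈0))))
    (λ x≉0 → begin
      χ ⟨ x ⟩ K.* S χ                    ≈⟨ *-distribˡ-∑𝔽 (χ ⟨ x ⟩) (χ ⟨_⟩) ⟩
      ∑𝔽 (λ y → χ ⟨ x ⟩ K.* χ ⟨ y ⟩)    ≈⟨ ∑𝔽-cong (⟨⟩-* χ x) ⟨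
      ∑𝔽 (λ y → χ ⟨ x * y ⟩)             ≈⟨ ∑𝔽-substitute (scaling x x≉0) (⟨⟩-cong χ) ⟨
      S χ                                ≈⟨ K.*-identityˡ (S χ) ⟨
      K.1# K.* S χ                       ≈⟨ K.*-congʳ (⟨⟩-ε x≉0) ⟨
      Ĝ.ε ⟨ x ⟩ K.* S χ                  ∎)
    where open ≈-Reasoning K.setoid

  -- By `⟨⟩*S`, the factor `S χ` turns each value of χ in the other sum into one of the trivial
  -- character, which ψ absorbs.
  S*S : ∀ χ ψ → S χ K.* S (χ · ψ) K.≈ S χ K.* S ψ
  S*S χ ψ = begin
    S χ K.* S (χ · ψ)                      ≈⟨ *-distribˡ-∑𝔽 (S χ) ((χ · ψ) ⟨_⟩) ⟩
    ∑𝔽 (λ x → S χ K.* (χ · ψ) ⟨ x ⟩)      ≈⟨ ∑𝔽-cong pointwise ⟩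
    ∑𝔽 (λ x → S χ K.* ψ ⟨ x ⟩)            ≈⟨ *-distribˡ-∑𝔽 (S χ) (ψ ⟨_⟩) ⟨
    S χ K.* S ψ                            ∎
    where
    open ≈-Reasoning K.setoid
    pointwise : ∀ x → S χ K.* (χ · ψ) ⟨ x ⟩ K.≈ S χ K.* ψ ⟨ x ⟩
    pointwise x = begin
      S χ K.* (χ · ψ) ⟨ x ⟩
        ≈⟨ K.*-congˡ (⟨⟩-· χ ψ x) ⟩
      S χ K.* (χ ⟨ x ⟩ K.* ψ ⟨ x ⟩)
        ≈⟨ KS.solve 3 (λ s a b → s KS.:* (a KS.:* b) KS.:= (a KS.:* s) KS.:* b)
             K.refl (S χ) (χ ⟨ x ⟩) (ψ ⟨ x ⟩) ⟩
      (χ ⟨ x ⟩ K.* S χ) K.* ψ ⟨ x ⟩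
        ≈⟨ K.*-congʳ (⟨⟩*S χ x) ⟩
      (Ĝ.ε ⟨ x ⟩ K.* S χ) K.* ψ ⟨ x ⟩
        ≈⟨ KS.solve 3 (λ s a b → (a KS.:* s) KS.:* b KS.:= s KS.:* (b KS.:* a))
             K.refl (S χ) (Ĝ.ε ⟨ x ⟩) (ψ ⟨ x ⟩) ⟩
      S χ K.* (ψ ⟨ x ⟩ K.* Ĝ.ε ⟨ x ⟩)
        ≈⟨ K.*-congˡ (⟨⟩-absorbʳ ψ x) ⟩
      S χ K.* ψ ⟨ x ⟩ ∎

  S*S-self : ∀ χ → S χ K.* S χ K.≈ S χ K.* S Ĝ.ε
  S*S-self χ = K.trans (K.*-congˡ (S-cong (Ĝ.sym (Ĝ.identityʳ χ)))) (S*S χ Ĝ.ε)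

  -- The coefficient of A(s) after x = y s: the sum of B((1 - y s) / (1 - y)) over y ≠ 0.
  slice : Character → Carrier → K.Carrier
  slice B s = ∑𝔽 λ y → Ĝ.ε ⟨ y ⟩ K.* (conj B ⟨ 1# - y ⟩ K.* B ⟨ 1# - y * s ⟩)

  -- With v = 1 / (1 - y), the fraction (1 - y s) / (1 - y) is the affine function (1 - s) v + s.
  line : Character → Carrier → K.Carrier
  line B s = ∑𝔽 λ v → B ⟨ (1# - s) * v + s ⟩

  -- Scaling by y requires y ≠ 0. At y = 0 the factor Ā(y) vanishes, and `ε ⟨ y ⟩` = Ā(y) A(y)
  -- remembers this.
  J-product-slices : ∀ A B →
    J (conj A) (conj B) K.* J A B K.≈ ∑𝔽 λ s → A ⟨ s ⟩ K.* slice B s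
  J-product-slices A B = begin
    J (conj A) (conj B) K.* J A B
      ≈⟨ *-distribʳ-∑𝔽 (J A B) (λ y → conj A ⟨ y ⟩ K.* conj B ⟨ 1# - y ⟩) ⟩
    ∑𝔽 (λ y → conj A ⟨ y ⟩ K.* conj B ⟨ 1# - y ⟩ K.* J A B)
      ≈⟨ ∑𝔽-cong expand ⟩
    ∑𝔽 (λ y → ∑𝔽 λ s → A ⟨ s ⟩ K.* summand y s)
      ≈⟨ ∑𝔽-comm (λ y s → A ⟨ s ⟩ K.* summand y s) ⟩
    ∑𝔽 (λ s → ∑𝔽 λ y → A ⟨ s ⟩ K.* summand y s)
      ≈⟨ ∑𝔽-cong (λ s → *-distribˡ-∑𝔽 (A ⟨ s ⟩) (λ y → summand y s)) ⟨
    ∑𝔽 (λ s → A ⟨ s ⟩ K.* slice B s) ∎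
    where
    open ≈-Reasoning K.setoid
    summand : Carrier → Carrier → K.Carrier
    summand y s = Ĝ.ε ⟨ y ⟩ K.* (conj B ⟨ 1# - y ⟩ K.* B ⟨ 1# - y * s ⟩)

    at-zero : ∀ {y} → y ≈ 0# → ∀ s → A ⟨ s ⟩ K.* summand y s K.≈ K.0#
    at-zero y≈0 s = K.trans
      (K.*-congˡ (K.trans (K.*-congʳ (⟨⟩-zero Ĝ.ε y≈0)) (K.zeroˡ _))) (K.zeroʳ _)

    regroup : ∀ y s →
      conj A ⟨ y ⟩ K.* conj B ⟨ 1# - y ⟩ K.* (A ⟨ y * s ⟩ K.* B ⟨ 1# - y * s ⟩)
        K.≈ A ⟨ s ⟩ K.* summand y s
    regroup y s = K.trans (K.*-congˡ (K.*-congʳ (⟨⟩-* A y s))) (K.trans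
      (KS.solve 5 (λ ā b̄ a a′ b → ā KS.:* b̄ KS.:* (a KS.:* a′ KS.:* b)
          KS.:= a′ KS.:* ((ā KS.:* a) KS.:* (b̄ KS.:* b)))
        K.refl (conj A ⟨ y ⟩) (conj B ⟨ 1# - y ⟩) (A ⟨ y ⟩) (A ⟨ s ⟩) (B ⟨ 1# - y * s ⟩))
      (K.*-congˡ (K.*-congʳ (⟨⟩-conj A y))))

    expand : ∀ y → conj A ⟨ y ⟩ K.* conj B ⟨ 1# - y ⟩ K.* J A B
                     K.≈ ∑𝔽 λ s → A ⟨ s ⟩ K.* summand y s
    expand y = zero-or-not y
      (λ y≈0 → K.trans
        (K.trans (K.*-congʳ (K.trans (K.*-congʳ (⟨⟩-zero (conj A) y≈0)) (K.zeroˡ _))) (K.zeroˡ _))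
        (K.sym (∑𝔽-zero (at-zero y≈0))))
      (λ y≉0 → begin
        conj A ⟨ y ⟩ K.* conj B ⟨ 1# - y ⟩ K.* J A B
          ≈⟨ K.*-congˡ (∑𝔽-substitute (scaling y y≉0)
               (λ x≈x′ → K.*-cong (⟨⟩-cong A x≈x′) (⟨⟩-cong B (+-congˡ (-‿cong x≈x′))))) ⟩
        conj A ⟨ y ⟩ K.* conj B ⟨ 1# - y ⟩ K.* ∑𝔽 (λ s → A ⟨ y * s ⟩ K.* B ⟨ 1# - y * s ⟩)
          ≈⟨ *-distribˡ-∑𝔽 _ (λ s → A ⟨ y * s ⟩ K.* B ⟨ 1# - y * s ⟩) ⟩
        ∑𝔽 (λ s → conj A ⟨ y ⟩ K.* conj B ⟨ 1# - y ⟩ K.* (A ⟨ y * s ⟩ K.* B ⟨ 1# - y * s ⟩))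
          ≈⟨ ∑𝔽-cong (regroup y) ⟩
        ∑𝔽 (λ s → A ⟨ s ⟩ K.* summand y s) ∎)

  -- Under v = 1 / (1 - y) the points v ≠ 0 correspond to y ≠ 1, and y = 1 contributes B̄(0) = 0.
  -- The two extra terms are v = 0, giving B(s), and y = 0, that is v = 1, giving 1.
  line-slice : ∀ B s → line B s K.≈ B ⟨ s ⟩ K.+ (K.1# K.+ slice B s)
  line-slice B s = begin
    line B s
      ≈⟨ ∑𝔽-puncture 0# (λ v≈v′ → ⟨⟩-cong B (+-congʳ (*-congˡ v≈v′))) ⟩
    B ⟨ (1# - s) * 0# + s ⟩ K.+ ∑𝔽 punctured
      ≈⟨ K.+-cong (⟨⟩-cong B (trans (+-congʳ (zeroʳ (1# - s))) (+-identityˡ s)))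
                  (∑𝔽-cong (K.sym ∘ fraction)) ⟩
    B ⟨ s ⟩ K.+ ∑𝔽 (λ v → ratio (1# - v ⁻¹))
      ≈⟨ K.+-congˡ (∑𝔽-substitute reciprocal (λ w≈w′ → ratio-cong (+-congˡ (-‿cong w≈w′)))) ⟨
    B ⟨ s ⟩ K.+ ∑𝔽 (λ w → ratio (1# - w))
      ≈⟨ K.+-congˡ (∑𝔽-substitute reflection ratio-cong) ⟨
    B ⟨ s ⟩ K.+ ∑𝔽 ratio
      ≈⟨ K.+-congˡ (∑𝔽-puncture 0# ratio-cong) ⟩
    B ⟨ s ⟩ K.+ (ratio 0# K.+ ∑𝔽 λ y → Ĝ.ε ⟨ y - 0# ⟩ K.* ratio y)
      ≈⟨ K.+-congˡ (K.+-cong ratio-0 (∑𝔽-cong λ y → K.*-congʳ {ratio y} (⟨⟩-cong Ĝ.ε (x-0≈x y)))) ⟩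
    B ⟨ s ⟩ K.+ (K.1# K.+ slice B s) ∎
    where
    open ≈-Reasoning K.setoid
    ratio punctured : Carrier → K.Carrier
    ratio y = conj B ⟨ 1# - y ⟩ K.* B ⟨ 1# - y * s ⟩
    punctured v = Ĝ.ε ⟨ v - 0# ⟩ K.* B ⟨ (1# - s) * v + s ⟩

    ratio-cong : Respects ratio
    ratio-cong y≈y′ = K.*-cong (⟨⟩-cong (conj B) (+-congˡ (-‿cong y≈y′)))
                               (⟨⟩-cong B (+-congˡ (-‿cong (*-congʳ y≈y′))))

    ratio-0 : ratio 0# K.≈ K.1#
    ratio-0 = K.trans
      (K.*-cong (K.trans (⟨⟩-cong (conj B) (x-0≈x 1#)) (⟨⟩-1 (conj B)))
        (K.trans (⟨⟩-cong B (trans (+-congˡ (-‿cong (zeroˡ s))) (x-0≈x 1#))) (⟨⟩-1 B)))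
      (K.*-identityˡ K.1#)

    fraction : ∀ v → ratio (1# - v ⁻¹) K.≈ punctured v
    fraction v = zero-or-not v
      (λ v≈0 → K.trans
        (K.trans (K.*-congʳ (⟨⟩-zero (conj B) (trans (1-[1-x]≈x (v ⁻¹)) (⁻¹-zero v≈0)))) (K.zeroˡ _))
        (K.sym (K.trans (K.*-congʳ (⟨⟩-zero Ĝ.ε (trans (x-0≈x v) v≈0))) (K.zeroˡ _))))
      (λ v≉0 → begin
        conj B ⟨ 1# - (1# - v ⁻¹) ⟩ K.* B ⟨ 1# - (1# - v ⁻¹) * s ⟩
          ≈⟨ K.*-congʳ (⟨⟩-cong (conj B) (1-[1-x]≈x (v ⁻¹))) ⟩
        conj B ⟨ v ⁻¹ ⟩ K.* B ⟨ 1# - (1# - v ⁻¹) * s ⟩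
          ≈⟨ K.*-congʳ (⟨⟩-⁻¹ B (v ⁻¹)) ⟨
        B ⟨ v ⁻¹ ⁻¹ ⟩ K.* B ⟨ 1# - (1# - v ⁻¹) * s ⟩
          ≈⟨ K.*-congʳ (⟨⟩-cong B (⁻¹-involutive v)) ⟩
        B ⟨ v ⟩ K.* B ⟨ 1# - (1# - v ⁻¹) * s ⟩
          ≈⟨ ⟨⟩-* B v _ ⟨
        B ⟨ v * (1# - (1# - v ⁻¹) * s) ⟩
          ≈⟨ ⟨⟩-cong B (clear v≉0) ⟩
        B ⟨ (1# - s) * v + s ⟩
          ≈⟨ K.*-identityˡ _ ⟨
        K.1# K.* B ⟨ (1# - s) * v + s ⟩
          ≈⟨ K.*-congʳ (⟨⟩-ε (v≉0 ∘ trans (sym (x-0≈x v)))) ⟨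
        punctured v ∎)
      where
      clear : ¬ v ≈ 0# → v * (1# - (1# - v ⁻¹) * s) ≈ (1# - s) * v + s
      clear v≉0 = trans
        (FS.solve 3 (λ v u s → let one = FS.con (+ 1) in
            v FS.:* (one FS.:- (one FS.:- u) FS.:* s) FS.:= (one FS.:- s) FS.:* v FS.:+ (v FS.:* u) FS.:* s)
          refl v (v ⁻¹) s)
        (+-congˡ (trans (*-congʳ (⁻¹-inverseʳ v≉0)) (*-identityˡ s)))

  line-cong : ∀ B → Respects (line B)
  line-cong B s≈s′ = ∑𝔽-cong λ v →
    ⟨⟩-cong B (+-cong (*-congʳ {v} (+-congˡ (-‿cong s≈s′))) s≈s′)

  line-1 : ∀ B → line B 1# K.≈ q
  line-1 B = ∑𝔽-cong λ v → K.trans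
    (⟨⟩-cong B (FS.solve 1 (λ v → let one = FS.con (+ 1) in
      (one FS.:- one) FS.:* v FS.:+ one FS.:= one) refl v))
    (⟨⟩-1 B)

  line-≉1 : ∀ B {s} → ¬ s - 1# ≈ 0# → line B s K.≈ S B
  line-≉1 B {s} s-1≉0 = K.sym (K.trans
    (∑𝔽-substitute (translation s) (⟨⟩-cong B))
    (∑𝔽-substitute (scaling (1# - s) 1-s≉0) (λ x≈y → ⟨⟩-cong B (+-congʳ x≈y))))
    where
    1-s≉0 : ¬ 1# - s ≈ 0#
    1-s≉0 eq = s-1≉0 (x≈y⇒x-y≈0 (sym (x-y≈0⇒x≈y eq)))

  -- The sums S(AB) and S(A) complete every slice to a line. A line with s ≠ 1 runs through the
  -- whole field and gives S(B), while the line with s = 1 is constant and gives q.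
  J-product : ∀ A B → J (conj A) (conj B) K.* J A B K.+ (S (A · B) K.+ S A K.+ S B)
                        K.≈ q K.+ S A K.* S B
  J-product A B = begin
    J (conj A) (conj B) K.* J A B K.+ (S (A · B) K.+ S A K.+ S B)
      ≈⟨ K.+-cong (J-product-slices A B) (K.+-congʳ (K.+-congʳ (∑𝔽-cong (⟨⟩-· A B)))) ⟩
    ∑𝔽 A*slice K.+ (∑𝔽 A*B K.+ S A K.+ S B)
      ≈⟨ KS.solve 4 (λ t u v w → t KS.:+ (u KS.:+ v KS.:+ w) KS.:= (u KS.:+ (v KS.:+ t)) KS.:+ w)
           K.refl (∑𝔽 A*slice) (∑𝔽 A*B) (S A) (S B) ⟩
    ∑𝔽 A*B K.+ (S A K.+ ∑𝔽 A*slice) K.+ S B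
      ≈⟨ K.+-congʳ (K.trans (∑𝔽-distrib-+ A*B (λ s → A ⟨ s ⟩ K.+ A*slice s))
           (K.+-congˡ (∑𝔽-distrib-+ (A ⟨_⟩) A*slice))) ⟨
    ∑𝔽 (λ s → A*B s K.+ (A ⟨ s ⟩ K.+ A*slice s)) K.+ S B
      ≈⟨ K.+-congʳ (∑𝔽-cong collect) ⟩
    ∑𝔽 A*line K.+ S B
      ≈⟨ K.+-congʳ (∑𝔽-puncture 1# (λ s≈s′ → K.*-cong (⟨⟩-cong A s≈s′) (line-cong B s≈s′))) ⟩
    A*line 1# K.+ ∑𝔽 (λ s → Ĝ.ε ⟨ s - 1# ⟩ K.* A*line s) K.+ S B
      ≈⟨ K.+-congʳ (K.+-cong
           (K.trans (K.*-cong (⟨⟩-1 A) (line-1 B)) (K.*-identityˡ q))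
           (∑𝔽-cong λ s → off-1 s)) ⟩
    q K.+ rest K.+ S B
      ≈⟨ K.trans (K.+-assoc q rest (S B)) (K.+-congˡ (K.+-comm rest (S B))) ⟩
    -- The summand `S B` carried along from the left serves as the missing term at s = 1.
    q K.+ (S B K.+ rest)
      ≈⟨ K.+-congˡ (K.+-congʳ (K.trans (K.*-congʳ (⟨⟩-1 A)) (K.*-identityˡ (S B)))) ⟨
    q K.+ (A ⟨ 1# ⟩ K.* S B K.+ rest)
      ≈⟨ K.+-congˡ (∑𝔽-puncture 1# (λ s≈s′ → K.*-congʳ (⟨⟩-cong A s≈s′))) ⟨
    q K.+ ∑𝔽 (λ s → A ⟨ s ⟩ K.* S B)
      ≈⟨ K.+-congˡ (*-distribʳ-∑𝔽 (S B) (A ⟨_⟩)) ⟨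
    q K.+ S A K.* S B ∎
    where
    open ≈-Reasoning K.setoid
    A*slice A*B A*line : Carrier → K.Carrier
    A*slice s = A ⟨ s ⟩ K.* slice B s
    A*B s     = A ⟨ s ⟩ K.* B ⟨ s ⟩
    A*line s  = A ⟨ s ⟩ K.* line B s
    rest : K.Carrier
    rest = ∑𝔽 λ s → Ĝ.ε ⟨ s - 1# ⟩ K.* (A ⟨ s ⟩ K.* S B)

    collect : ∀ s → A*B s K.+ (A ⟨ s ⟩ K.+ A*slice s) K.≈ A*line s
    collect s = K.trans
      (KS.solve 3 (λ a b t → a KS.:* b KS.:+ (a KS.:+ a KS.:* t)
          KS.:= a KS.:* (b KS.:+ (KS.con (+ 1) KS.:+ t)))
        K.refl (A ⟨ s ⟩) (B ⟨ s ⟩) (slice B s))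
      (K.*-congˡ (K.sym (line-slice B s)))

    off-1 : ∀ s → Ĝ.ε ⟨ s - 1# ⟩ K.* A*line s K.≈ Ĝ.ε ⟨ s - 1# ⟩ K.* (A ⟨ s ⟩ K.* S B)
    off-1 s = zero-or-not (s - 1#)
      (λ s≈1 → K.trans (K.trans (K.*-congʳ (⟨⟩-zero Ĝ.ε s≈1)) (K.zeroˡ _))
        (K.sym (K.trans (K.*-congʳ (⟨⟩-zero Ĝ.ε s≈1)) (K.zeroˡ _))))
      (λ s≉1 → K.*-congˡ (K.*-congˡ (line-≉1 B s≉1)))

  -- Here r is q - 2, and the m of `invertible-product` is q - 1 = S(ε). A factor of an invertible
  -- element is invertible.
  J-invertible : ∀ {r} → q K.≈ K.1# K.+ (K.1# K.+ r) → InvertibleK q → InvertibleK r →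
                 ∀ A B → InvertibleK (J A B)
  J-invertible {r} q≈2+r q-inv r-inv A B = invertible-factorʳ (J (conj A) (conj B))
    (invertible-product
      (square A) (square B) (square (A · B))
      (S*S A B)
      (K.trans (K.*-congˡ (S-cong (Ĝ.comm A B))) (K.trans (S*S B A) (K.*-comm (S B) (S A))))
      (K.trans (J-product A B) (K.+-congʳ q≈2+r))
      (invertible-cong q≈2+r q-inv) r-inv)
    where
    open InvertibilityLemmas K
    Sε≈1+r : S Ĝ.ε K.≈ K.1# K.+ r
    Sε≈1+r = RingProperties.+-cancelˡ K.ring K.1# _ _ (K.trans (K.sym q≈1+Sε) q≈2+r)
    square : ∀ χ → S χ K.* S χ K.≈ S χ K.* (K.1# K.+ r)
    square χ = K.trans (S*S-self χ) (K.*-congˡ Sε≈1+r)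

  -- Reflection of the Appell-Lauricella sum.

  -- The sum in `F-D` with `D` for `C · conj A`; without the normalising Jacobi sum its reflection
  -- involves no inverses in K.
  appell : ∀ {n} → Character → Vector Character n → Character → Vector Carrier n → K.Carrier
  appell A B D λs = ∑𝔽 λ y → A ⟨ y ⟩ K.* D ⟨ 1# - y ⟩ K.* ∏K λ i → conj (B i) ⟨ 1# - λs i * y ⟩

  -- The substitution y = 1 - (1 - z)⁻¹ = z / (z - 1); since 0 ⁻¹ = 0 it fixes z = 1,
  -- where both integrands vanish.
  appell-reflect : ∀ {n} A (B : Vector Character n) D E λs → E Ĝ.≈ conj (A · D) · ∏χ B →
                   appell A B D λs K.≈ A ⟨ - 1# ⟩ K.* appell A B E (λ i → 1# - λs i)
  appell-reflect A B D E λs E≈ = begin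
    appell A B D λs
      ≈⟨ ∑𝔽-substitute reflection term-cong ⟩
    ∑𝔽 (λ w → term (1# - w))
      ≈⟨ ∑𝔽-substitute reciprocal (λ w≈w′ → term-cong (+-congˡ (-‿cong w≈w′))) ⟩
    ∑𝔽 (λ u → term (1# - u ⁻¹))
      ≈⟨ ∑𝔽-substitute reflection (λ u≈u′ → term-cong (+-congˡ (-‿cong (⁻¹-cong u≈u′)))) ⟩
    ∑𝔽 (λ z → term (1# - (1# - z) ⁻¹))
      ≈⟨ ∑𝔽-cong pointwise ⟩
    ∑𝔽 (λ z → A ⟨ - 1# ⟩ K.* term′ z)
      ≈⟨ *-distribˡ-∑𝔽 (A ⟨ - 1# ⟩) term′ ⟨
    A ⟨ - 1# ⟩ K.* appell A B E (λ i → 1# - λs i) ∎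
    where
    open ≈-Reasoning K.setoid
    module ∏ = CommutativeMonoidSum K.*-commutativeMonoid

    term term′ : Carrier → K.Carrier
    term  y = A ⟨ y ⟩ K.* D ⟨ 1# - y ⟩ K.* ∏K λ i → conj (B i) ⟨ 1# - λs i * y ⟩
    term′ z = A ⟨ z ⟩ K.* E ⟨ 1# - z ⟩ K.* ∏K λ i → conj (B i) ⟨ 1# - (1# - λs i) * z ⟩

    term-cong : Respects term
    term-cong y≈y′ = K.*-cong
      (K.*-cong (⟨⟩-cong A y≈y′) (⟨⟩-cong D (+-congˡ (-‿cong y≈y′))))
      (∏.sum-cong-≋ λ i → ⟨⟩-cong (conj (B i)) (+-congˡ (-‿cong (*-congˡ y≈y′))))

    at-1 : ∀ {a d p} → d K.≈ K.0# → a K.* d K.* p K.≈ K.0#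
    at-1 d≈0 = K.trans (K.*-congʳ (K.trans (K.*-congˡ d≈0) (K.zeroʳ _))) (K.zeroˡ _)

    pointwise : ∀ z → term (1# - (1# - z) ⁻¹) K.≈ A ⟨ - 1# ⟩ K.* term′ z
    pointwise z = zero-or-not (1# - z)
      (λ z≈1 → K.trans
        (at-1 (⟨⟩-zero D (trans (1-[1-x]≈x _) (⁻¹-zero z≈1))))
        (K.sym (K.trans (K.*-congˡ (at-1 (⟨⟩-zero E z≈1))) (K.zeroʳ _))))
      away
      where
      w : Carrier
      w = (1# - z) ⁻¹

      -- The Möbius map z ↦ 1 - w has numerator - z and denominator 1 - z = w ⁻¹.
      away : ¬ 1# - z ≈ 0# → term (1# - w) K.≈ A ⟨ - 1# ⟩ K.* term′ z
      away z≉1 = begin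
        A ⟨ 1# - w ⟩ K.* D ⟨ 1# - (1# - w) ⟩ K.* ∏K (λ i → conj (B i) ⟨ 1# - λs i * (1# - w) ⟩)
          ≈⟨ K.*-cong (K.*-cong A-factor (⟨⟩-cong D (1-[1-x]≈x w))) B-factor ⟩
        A ⟨ - 1# ⟩ K.* (A ⟨ z ⟩ K.* A ⟨ w ⟩) K.* D ⟨ w ⟩ K.* (∏B̄w K.* ∏B̄)
          ≈⟨ KS.solve 6 (λ s a a′ d b p → s KS.:* (a KS.:* a′) KS.:* d KS.:* (b KS.:* p)
                 KS.:= s KS.:* (a KS.:* (a′ KS.:* d KS.:* b) KS.:* p))
               K.refl (A ⟨ - 1# ⟩) (A ⟨ z ⟩) (A ⟨ w ⟩) (D ⟨ w ⟩) ∏B̄w ∏B̄ ⟩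
        A ⟨ - 1# ⟩ K.* (A ⟨ z ⟩ K.* (A ⟨ w ⟩ K.* D ⟨ w ⟩ K.* ∏B̄w) K.* ∏B̄)
          ≈⟨ K.*-congˡ (K.*-congʳ (K.*-congˡ E-factor)) ⟨
        A ⟨ - 1# ⟩ K.* term′ z ∎
        where
        ∏B̄w ∏B̄ : K.Carrier
        ∏B̄w = ∏K λ i → conj (B i) ⟨ w ⟩
        ∏B̄  = ∏K λ i → conj (B i) ⟨ 1# - (1# - λs i) * z ⟩

        [1-z]w≈1 : (1# - z) * w ≈ 1#
        [1-z]w≈1 = ⁻¹-inverseʳ z≉1

        A-factor : A ⟨ 1# - w ⟩ K.≈ A ⟨ - 1# ⟩ K.* (A ⟨ z ⟩ K.* A ⟨ w ⟩)
        A-factor = K.trans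
          (⟨⟩-cong A (trans (+-congʳ (sym [1-z]w≈1))
            (FS.solve 2 (λ z w → let one = FS.con (+ 1) in
              (one FS.:- z) FS.:* w FS.:- w FS.:= FS.:- one FS.:* (z FS.:* w)) refl z w)))
          (K.trans (⟨⟩-* A (- 1#) (z * w)) (K.*-congˡ (⟨⟩-* A z w)))

        -- Writing 1 as (1 - z) w makes both sides homogeneous of degree one in w, so that a
        -- polynomial identity remains.
        argument : ∀ l → 1# - l * (1# - w) ≈ w * (1# - (1# - l) * z)
        argument l = trans
          (+-cong (sym [1-z]w≈1) (-‿cong (*-congˡ (+-congʳ (sym [1-z]w≈1)))))
          (FS.solve 3 (λ l z w → let one = FS.con (+ 1); t = (one FS.:- z) FS.:* w in
            t FS.:- l FS.:* (t FS.:- w) FS.:= w FS.:* (one FS.:- (one FS.:- l) FS.:* z))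
            refl l z w)

        B-factor : ∏K (λ i → conj (B i) ⟨ 1# - λs i * (1# - w) ⟩) K.≈ ∏B̄w K.* ∏B̄
        B-factor = K.trans
          (∏.sum-cong-≋ λ i → K.trans (⟨⟩-cong (conj (B i)) (argument (λs i)))
            (⟨⟩-* (conj (B i)) w (1# - (1# - λs i) * z)))
          (∏.∑-distrib-+ (λ i → conj (B i) ⟨ w ⟩) (λ i → conj (B i) ⟨ 1# - (1# - λs i) * z ⟩))

        -- `E` is designed to collect the powers of w split off by the other factors: A D ∏B̄ at w
        -- is the conjugate character at w⁻¹ = 1 - z.
        E-factor : E ⟨ 1# - z ⟩ K.≈ A ⟨ w ⟩ K.* D ⟨ w ⟩ K.* ∏B̄w
        E-factor = begin
          E ⟨ 1# - z ⟩
            ≈⟨ ⟨⟩-congˡ E≈ (1# - z) ⟩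
          (conj (A · D) · ∏χ B) ⟨ 1# - z ⟩
            ≈⟨ ⟨⟩-· (conj (A · D)) (∏χ B) (1# - z) ⟩
          conj (A · D) ⟨ 1# - z ⟩ K.* ∏χ B ⟨ 1# - z ⟩
            ≈⟨ K.*-cong (K.trans (K.sym (⟨⟩-⁻¹ (A · D) (1# - z))) (⟨⟩-· A D w))
                 (⟨⟩-∏ B z≉1) ⟩
          A ⟨ w ⟩ K.* D ⟨ w ⟩ K.* ∏K (λ i → B i ⟨ 1# - z ⟩)
            ≈⟨ K.*-congˡ (∏.sum-cong-≋ λ i → K.trans
                 (⟨⟩-cong (B i) (sym (⁻¹-involutive (1# - z)))) (⟨⟩-⁻¹ (B i) w)) ⟩
          A ⟨ w ⟩ K.* D ⟨ w ⟩ K.* ∏B̄w ∎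

  J-congʳ : ∀ A {B B′} → B Ĝ.≈ B′ → J A B K.≈ J A B′
  J-congʳ A B≈B′ = ∑𝔽-cong λ x → K.*-congˡ {A ⟨ x ⟩} (⟨⟩-congˡ B≈B′ (1# - x))

  ⟨-1⟩² : ∀ A → A ⟨ - 1# ⟩ K.* A ⟨ - 1# ⟩ K.≈ K.1#
  ⟨-1⟩² A = K.trans (K.sym (⟨⟩-* A (- 1#) (- 1#)))
    (K.trans (⟨⟩-cong A (FS.solve 0 (FS.:- FS.con (+ 1) FS.:* FS.:- FS.con (+ 1) FS.:= FS.con (+ 1)) refl))
      (⟨⟩-1 A))

  -- As A cancels in `E`, the normalising sum J(A, E) on the right equals the numerator J(A, C̄ ∏B),
  -- and the two cancel. The factor A(-1) from the substitution may stand in the denominator, being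
  -- its own inverse.
  F-D-reflect : (∀ A B → InvertibleK (J A B)) →
    ∀ {n} (A C : Character) (B : Vector Character n) (λs : Vector Carrier n) →
    Σ[ inv₁ ∈ InvertibleK (J A (C · conj A)) ]
    Σ[ inv₂ ∈ InvertibleK (J A (A · conj C · ∏χ B · conj A)) ]
    Σ[ inv₃ ∈ InvertibleK (A ⟨ - 1# ⟩ K.* J A (C · conj A)) ]
      F-D A B C λs inv₁
        K.≈ (J A (conj C · ∏χ B) / (A ⟨ - 1# ⟩ K.* J A (C · conj A)) [ inv₃ ])
            K.* F-D A B (A · conj C · ∏χ B) (λ i → 1# - λs i) inv₂
  F-D-reflect J-inv A C B λs = inv₁ , inv₂ , inv₃ , (begin
    K.1# K.* j₁ K.* appell A B (C · conj A) λs
      ≈⟨ K.*-congˡ (appell-reflect A B (C · conj A) E λs E≈′) ⟩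
    K.1# K.* j₁ K.* (s K.* T)
      ≈⟨ KS.solve 3 (λ j s t → KS.con (+ 1) KS.:* j KS.:* (s KS.:* t) KS.:= KS.con (+ 1) KS.:* (s KS.:* j KS.:* t))
           K.refl j₁ s T ⟩
    K.1# K.* (s K.* j₁ K.* T)
      ≈⟨ K.*-congʳ (K.trans (K.*-congʳ (J-congʳ A (Ĝ.sym E≈))) (proj₂ (proj₂ inv₂))) ⟨
    (J A (conj C · ∏χ B) K.* j₂) K.* (s K.* j₁ K.* T)
      ≈⟨ KS.solve 4 (λ a b u t → (a KS.:* b) KS.:* (u KS.:* t) KS.:= a KS.:* u KS.:* (KS.con (+ 1) KS.:* b KS.:* t))
           K.refl (J A (conj C · ∏χ B)) j₂ (s K.* j₁) T ⟩
    J A (conj C · ∏χ B) K.* (s K.* j₁) K.* (K.1# K.* j₂ K.* T) ∎)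
    where
    open ≈-Reasoning K.setoid
    open InvertibilityLemmas K using (invertible)
    open AbelianGroupProperties characterGroup using (xyx⁻¹≈y)

    E : Character
    E = A · conj C · ∏χ B · conj A
    s T j₁ j₂ : K.Carrier
    s = A ⟨ - 1# ⟩
    T = appell A B E (λ i → 1# - λs i)

    inv₁ : InvertibleK (J A (C · conj A))
    inv₁ = J-inv A (C · conj A)
    j₁ = proj₁ inv₁
    inv₂ : InvertibleK (J A E)
    inv₂ = J-inv A E
    j₂ = proj₁ inv₂
    inv₃ : InvertibleK (s K.* J A (C · conj A))
    inv₃ = invertible (begin
      s K.* J A (C · conj A) K.* (s K.* j₁)
        ≈⟨ KS.solve 3 (λ s a b → s KS.:* a KS.:* (s KS.:* b) KS.:= (s KS.:* s) KS.:* (a KS.:* b))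
             K.refl s (J A (C · conj A)) j₁ ⟩
      (s K.* s) K.* (J A (C · conj A) K.* j₁)
        ≈⟨ K.*-cong (⟨-1⟩² A) (proj₂ (proj₂ inv₁)) ⟩
      K.1# K.* K.1#
        ≈⟨ K.*-identityˡ K.1# ⟩
      K.1# ∎)

    E≈ : E Ĝ.≈ conj C · ∏χ B
    E≈ = Ĝ.trans (Ĝ.∙-congʳ (Ĝ.assoc A (conj C) (∏χ B))) (xyx⁻¹≈y A (conj C · ∏χ B))

    E≈′ : E Ĝ.≈ conj (A · (C · conj A)) · ∏χ B
    E≈′ = Ĝ.trans E≈ (Ĝ.∙-congʳ (Ĝ.⁻¹-cong (Ĝ.sym
      (Ĝ.trans (Ĝ.sym (Ĝ.assoc A C (conj A))) (xyx⁻¹≈y A C)))))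

  q≈cardinality : q K.≈ cardinality K× K.1#
  q≈cardinality = ∑.sum-replicate cardinality

-- Positive integers in the constructive complex numbers.

module ComplexNaturals where

  open AdjoinI ℝ-commutativeRing using (_+i_; mk≈ᵢ)
  open MonoidMult ℂ.+-monoid using (_×_)
  open MonoidMult ℚ.+-0-monoid using () renaming (_×_ to _×ℚ_)
  open ≈-Reasoning ℂ.setoid

  embed : ℚ → ℂ
  embed p = fromℚ p +i fromℚ 0ℚ

  fromℚ-cong : ∀ x p → (∀ n → seq x n ≡ p) → x ≈ℝ fromℚ p
  fromℚ-cong x p x≡p = mk≈ℝ (CloseProperties.close-pointwise {seq x} {λ _ → p} (cauchy x) x≡p)

  embed-+ : ∀ p r → embed p ℂ.+ embed r ℂ.≈ embed (p ℚ.+ r)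
  embed-+ p r = mk≈ᵢ (fromℚ-cong (fromℚ p +ℝ fromℚ r) (p ℚ.+ r) λ _ → ≡.refl)
                     (fromℚ-cong (fromℚ 0ℚ +ℝ fromℚ 0ℚ) 0ℚ λ _ → ≡.refl)

  embed-* : ∀ p r → embed p ℂ.* embed r ℂ.≈ embed (p ℚ.* r)
  embed-* p r = mk≈ᵢ
    (fromℚ-cong (fromℚ p *ℝ fromℚ r +ℝ -ℝ (fromℚ 0ℚ *ℝ fromℚ 0ℚ)) (p ℚ.* r)
      λ _ → ℚ.+-identityʳ (p ℚ.* r))
    (fromℚ-cong (fromℚ p *ℝ fromℚ 0ℚ +ℝ fromℚ 0ℚ *ℝ fromℚ r) 0ℚ
      λ _ → ≡.cong₂ ℚ._+_ (ℚ.*-zeroʳ p) (ℚ.*-zeroˡ r))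

  embed-× : ∀ n → n × ℂ.1# ℂ.≈ embed (n ×ℚ 1ℚ)
  embed-× zero    = ℂ.refl
  embed-× (suc n) = ℂ.trans (ℂ.+-congˡ (embed-× n)) (embed-+ 1ℚ (n ×ℚ 1ℚ))

  ×1-nonNegative : ∀ n → 0ℚ ℚ.≤ n ×ℚ 1ℚ
  ×1-nonNegative zero    = ℚ.≤-refl
  ×1-nonNegative (suc n) = ℚ.+-mono-≤ (ℚ.nonNegative⁻¹ 1ℚ) (×1-nonNegative n)

  ×1-positive : ∀ n → 0ℚ ℚ.< suc n ×ℚ 1ℚ
  ×1-positive n = ℚ.+-mono-<-≤ (ℚ.positive⁻¹ 1ℚ) (×1-nonNegative n)

  -- Inverting a general Cauchy sequence takes a bound away from zero. Positive integers are
  -- constant sequences, inverted by the constant reciprocal.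
  suc×1-invertible : ∀ n → Invertible ℂ._≈_ ℂ.1# ℂ._*_ (suc n × ℂ.1#)
  suc×1-invertible n = invertible (begin
    suc n × ℂ.1# ℂ.* embed (ℚ.1/ m)  ≈⟨ ℂ.*-congʳ (embed-× (suc n)) ⟩
    embed m ℂ.* embed (ℚ.1/ m)       ≈⟨ embed-* m (ℚ.1/ m) ⟩
    embed (m ℚ.* ℚ.1/ m)             ≡⟨ ≡.cong embed (ℚ.*-inverseʳ m) ⟩
    ℂ.1#                             ∎)
    where
    open InvertibilityLemmas ℂ-commutativeRing using (invertible)
    m : ℚ
    m = suc n ×ℚ 1ℚ
    instance
      m-nonZero : ℚ.NonZero m
      m-nonZero = ℚ.pos⇒nonZero m {{ℚ.positive (×1-positive n)}}

-- Specialisation to complex characters.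

-- The bound makes q - 2 a positive integer. Exponent 0 would leave a single element, against 0 ≠ 1;
-- otherwise q is at least p, and p is at least 3.
odd-prime-power-cardinality : ∀ {c ℓ} (𝔽 : FiniteField c ℓ) {p} e → Prime p → p ≢ 2 →
  FiniteField.cardinality 𝔽 ≡ p ^ e → 3 ≤ FiniteField.cardinality 𝔽
odd-prime-power-cardinality 𝔽 zero _ _ card≡1 = contradiction 0≈1 0≉1
  where
  open FiniteField 𝔽
  open Inverse enumeration using (from; strictlyInverseˡ)
  Fin1-prop : ∀ {n} → n ≡ 1 → (i j : Fin n) → i ≡ j
  Fin1-prop ≡.refl Fin.zero Fin.zero = ≡.refl
  0≈1 : 0# ≈ 1#
  0≈1 = trans (sym (strictlyInverseˡ 0#))
    (trans (Inverse.to-cong enumeration (Fin1-prop card≡1 (from 0#) (from 1#))) (strictlyInverseˡ 1#))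
odd-prime-power-cardinality 𝔽 {p} (suc e) p-prime p≢2 card≡p^e =
  ≡.subst (3 ≤_) (≡.sym card≡p^e) (ℕ.≤-trans 3≤p (ℕ.m≤m*n p (p ^ e) {{ℕ.m^n≢0 p e}}))
  where
  instance
    p-nonZero : ℕ.NonZero p
    p-nonZero = prime⇒nonZero p-prime
  3≤p : 3 ≤ p
  3≤p = ℕ.≤∧≢⇒< (ℕ.nonTrivial⇒n>1 p {{prime⇒nonTrivial p-prime}}) (p≢2 ∘ ≡.sym)

corollary6p3 : ∀ {c ℓ} (𝔽 : FiniteField c ℓ) (p e : ℕ) →
  Prime p → p ≢ 2 → FiniteField.cardinality 𝔽 ≡ p ^ e →
  (n : ℕ) → 2 ≤ n →
  let open FiniteField 𝔽
      open ComplexCharacterSums 𝔽 in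
  (A C : Character) (B : Vector Character n) (λs : Vector Carrier n) →
  Σ[ inv₁ ∈ Invertibleℂ (J A (C · conj A)) ]
  Σ[ inv₂ ∈ Invertibleℂ (J A (A · conj C · ∏χ B · conj A)) ]
  Σ[ inv₃ ∈ Invertibleℂ (A ⟨ - 1# ⟩ ℂ.* J A (C · conj A)) ]
    F-D A B C λs inv₁
      ℂ.≈ (J A (conj C · ∏χ B) / (A ⟨ - 1# ⟩ ℂ.* J A (C · conj A)) [ inv₃ ])
          ℂ.* F-D A B (A · conj C · ∏χ B) (λ i → 1# - λs i) inv₂
corollary6p3 𝔽 p e p-prime p≢2 card≡p^e n _ A C B λs = F-D-reflect J-inv A C B λs
  where
  open CharacterProperties ℂ-commutativeRing 𝔽
  open ComplexCharacterSums 𝔽 using (Invertibleℂ; J)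
  open FiniteField 𝔽 using (cardinality)
  open MonoidMult ℂ.+-monoid using (_×_)
  open ComplexNaturals using (suc×1-invertible)
  open InvertibilityLemmas ℂ-commutativeRing using (invertible-cong)

  k : ℕ
  -- With q = k + 3 both q and r = q - 2 = k + 1 are successors, as `suc×1-invertible` demands, and
  -- `suc (suc (suc k)) × 1` unfolds to `1 + (1 + r)`.
  k = cardinality ℕ.∸ 3

  q≈3+k : q ℂ.≈ suc (suc (suc k)) × ℂ.1#
  q≈3+k = ℂ.trans q≈cardinality (ℂ.reflexive (≡.cong (_× ℂ.1#)
    (≡.sym (ℕ.m+[n∸m]≡n (odd-prime-power-cardinality 𝔽 e p-prime p≢2 card≡p^e)))))

  J-inv : ∀ χ ψ → Invertibleℂ (J χ ψ)
  J-inv = J-invertible q≈3+k (invertible-cong (ℂ.sym q≈3+k) (suc×1-invertible (suc (suc k))))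
    (suc×1-invertible k)
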